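{- Let $G^\sigma$ be a signed cycle of order $n\ge 3$, so that its girth $g(G^\sigma)$ equals $n$, and let $\lambda\in\mathbb{R}$. Then \[ m(G^\sigma,\lambda)=n-g(G^\sigma)+1 \] if and only if one of the following holds: (i) $G^\sigma$ is a balanced cycle and $\lambda=2$; (ii) $G^\sigma$ is a balanced cycle of even order and $\lambda=-2$; (iii) $G^\sigma$ is an unbalanced cycle of odd order and $\lambda=-2$.
   Context: A signed graph $G^\sigma=(G,\sigma)$ consists of a finite simple undirected graph $G=(V,E)$ and a sign function $\sigma:E\to\{+1,-1\}$; its order is $n=|V|$ and its girth $g(G^\sigma)$ is the length of a shortest cycle of $G$. A signed cycle of order $n$ is a signed graph whose underlying graph is the cycle $C_n$; it is balanced if the product of the signs of its edges is $+1$, and unbalanced otherwise. The adjacency matrix $A(G^\sigma)=[a^\sigma_{ij}]$ has $a^\sigma_{ij}=\sigma(v_iv_j)$ if $v_i$ and $v_j$ are adjacent and $a^\sigma_{ij}=0$ otherwise. $m(G^\sigma,\lambda)=n-\operatorname{rank}(\lambda I-A(G^\sigma))$ denotes the multiplicity of $\lambda$ as an eigenvalue of $A(G^\sigma)$ (equal to $0$ if $\lambda$ is not an eigenvalue). -}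

module Defs where

open import Algebra.Bundles using (CommutativeRing)
open import Algebra.Structures using (IsCommutativeRing)
import Algebra.Properties.CommutativeMonoid.Sum as CommutativeMonoidSum
open import Data.Bool.Base using (if_then_else_)
open import Data.Fin.Base using (Fin; toℕ)
import Data.Fin.Properties as Fin
open import Data.Fin.Permutation using (Permutation′; _⟨$⟩ʳ_)
open import Data.Nat.Base as ℕ using (ℕ; zero; suc; _⊔_)
open import Data.Nat.DivMod using (_mod_)
import Data.Nat.Properties as ℕ
open import Data.Product.Base using (∃; _×_; _,_; proj₁; proj₂)
open import Data.Rational.Base as ℚ using (ℚ; 0ℚ; 1ℚ; ∣_∣)
import Data.Rational.Properties as ℚ
open import Data.Rational.Solver using (module +-*-Solver)
open import Data.Sign.Base as Sign using (Sign)
import Data.Sign.Properties as Sign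
open import Data.Sum.Base using (_⊎_)
open import Data.Vec.Functional using (Vector)
open import Function.Bundles using (_⇔_)
open import Function.Definitions using (Injective)
open import Level using (0ℓ)
open import Relation.Binary.Core using (Rel)
open import Relation.Binary.Definitions using (Decidable; Irreflexive; Symmetric)
open import Relation.Binary.PropositionalEquality
  using (_≡_; refl; sym; trans; cong; cong₂; subst)
open import Relation.Nullary.Decidable.Core using (does)
open import Relation.Nullary.Negation.Core using (¬_)

------------------------------------------------------------------------
-- Real numbers: Cauchy sequences of rationals, identified when their
-- difference tends to 0.

-- Eta is switched off (and the operations are defined by copatterns) so
-- that sums and products of reals do not unfold during unification.
record ℝ : Set where
  no-eta-equality
  field
    seq    : ℕ → ℚ
    cauchy : ∀ ε → 0ℚ ℚ.< ε →
             ∃ λ N → ∀ m n → N ℕ.≤ m → N ℕ.≤ n → ∣ seq m ℚ.- seq n ∣ ℚ.< ε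

open ℝ public

infix 4 _≈_

record _≈_ (x y : ℝ) : Set where
  constructor mk≈
  field
    close : ∀ ε → 0ℚ ℚ.< ε →
            ∃ λ N → ∀ n → N ℕ.≤ n → ∣ seq x n ℚ.- seq y n ∣ ℚ.< ε

open _≈_ public

private
  open +-*-Solver using (solve; _:=_; _:+_; _:*_; _:-_; :-_)

  flip : ∀ p q → ℚ.- (p ℚ.- q) ≡ q ℚ.- p
  flip = solve 2 (λ a b → :- (a :- b) := b :- a) refl

  neg-diff : ∀ p q → q ℚ.- p ≡ (ℚ.- p) ℚ.- (ℚ.- q)
  neg-diff = solve 2 (λ a b → b :- a := (:- a) :- (:- b)) refl

  add-back : ∀ p q → p ≡ (p ℚ.- q) ℚ.+ q
  add-back = solve 2 (λ a b → a := (a :- b) :+ b) refl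

  telescope : ∀ p q r → p ℚ.- r ≡ (p ℚ.- q) ℚ.+ (q ℚ.- r)
  telescope = solve 3 (λ a b c → a :- c := (a :- b) :+ (b :- c)) refl

  sum-diff : ∀ p q p′ q′ →
             (p ℚ.+ q) ℚ.- (p′ ℚ.+ q′) ≡ (p ℚ.- p′) ℚ.+ (q ℚ.- q′)
  sum-diff = solve 4 (λ a b c d → (a :+ b) :- (c :+ d) := (a :- c) :+ (b :- d)) refl

  product-diff : ∀ p q p′ q′ → p ℚ.* q ℚ.- p′ ℚ.* q′ ≡
                 p ℚ.* (q ℚ.- q′) ℚ.+ q′ ℚ.* (p ℚ.- p′)
  product-diff =
    solve 4 (λ a b c d → a :* b :- c :* d := a :* (b :- d) :+ d :* (a :- c)) refl

  0<1 : 0ℚ ℚ.< 1ℚ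
  0<1 = ℚ.positive⁻¹ 1ℚ

  -- ε can be split as B * δ for any positive B
  divide : ∀ B → 0ℚ ℚ.< B → ∀ ε → 0ℚ ℚ.< ε → ∃ λ δ → 0ℚ ℚ.< δ × B ℚ.* δ ≡ ε
  divide B 0<B ε 0<ε = B⁻¹ ℚ.* ε , 0<δ , B*δ≡ε
    where
    instance
      _ = ℚ.positive 0<B
      _ = ℚ.pos⇒nonZero B
    B⁻¹ = ℚ.1/ B
    0<δ : 0ℚ ℚ.< B⁻¹ ℚ.* ε
    0<δ = subst (ℚ._< B⁻¹ ℚ.* ε) (ℚ.*-zeroʳ B⁻¹)
      (ℚ.*-monoʳ-<-pos B⁻¹ {{ℚ.1/pos⇒pos B}} 0<ε)
    B*δ≡ε : B ℚ.* (B⁻¹ ℚ.* ε) ≡ ε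
    B*δ≡ε = trans (sym (ℚ.*-assoc B B⁻¹ ε))
      (trans (cong (ℚ._* ε) (ℚ.*-inverseʳ B)) (ℚ.*-identityˡ ε))

  half : ∀ ε → 0ℚ ℚ.< ε → ∃ λ δ → 0ℚ ℚ.< δ × δ ℚ.+ δ ≡ ε
  half ε 0<ε with divide (1ℚ ℚ.+ 1ℚ) (ℚ.positive⁻¹ (1ℚ ℚ.+ 1ℚ)) ε 0<ε
  ... | δ , 0<δ , eq = δ , 0<δ , trans (sym 2*δ) eq
    where
    2*δ : (1ℚ ℚ.+ 1ℚ) ℚ.* δ ≡ δ ℚ.+ δ
    2*δ = trans (ℚ.*-distribʳ-+ δ 1ℚ 1ℚ)
                (cong₂ ℚ._+_ (ℚ.*-identityˡ δ) (ℚ.*-identityˡ δ))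

  ∣p-p∣≡0 : ∀ p → ∣ p ℚ.- p ∣ ≡ 0ℚ
  ∣p-p∣≡0 p = cong ∣_∣ (ℚ.+-inverseʳ p)

  ∣p-q∣≡∣q-p∣ : ∀ p q → ∣ p ℚ.- q ∣ ≡ ∣ q ℚ.- p ∣
  ∣p-q∣≡∣q-p∣ p q = trans (sym (ℚ.∣-p∣≡∣p∣ (p ℚ.- q)))
    (cong ∣_∣ (flip p q))

  neg-close : ∀ {ε} p q → ∣ p ℚ.- q ∣ ℚ.< ε → ∣ (ℚ.- p) ℚ.- (ℚ.- q) ∣ ℚ.< ε
  neg-close {ε} p q =
    subst (ℚ._< ε) (trans (∣p-q∣≡∣q-p∣ p q) (cong ∣_∣ (neg-diff p q)))

  sum-close : ∀ {δ ε} p q p′ q′ → δ ℚ.+ δ ≡ ε →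
              ∣ p ℚ.- p′ ∣ ℚ.< δ → ∣ q ℚ.- q′ ∣ ℚ.< δ →
              ∣ (p ℚ.+ q) ℚ.- (p′ ℚ.+ q′) ∣ ℚ.< ε
  sum-close {δ} p q p′ q′ refl pδ qδ = begin-strict
    ∣ (p ℚ.+ q) ℚ.- (p′ ℚ.+ q′) ∣
      ≡⟨ cong ∣_∣ (sum-diff p q p′ q′) ⟩
    ∣ (p ℚ.- p′) ℚ.+ (q ℚ.- q′) ∣    ≤⟨ ℚ.∣p+q∣≤∣p∣+∣q∣ (p ℚ.- p′) (q ℚ.- q′) ⟩
    ∣ p ℚ.- p′ ∣ ℚ.+ ∣ q ℚ.- q′ ∣    <⟨ ℚ.+-mono-< pδ qδ ⟩
    δ ℚ.+ δ                          ∎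
    where open ℚ.≤-Reasoning

  chain-close : ∀ {δ ε} p q r → δ ℚ.+ δ ≡ ε →
                ∣ p ℚ.- q ∣ ℚ.< δ → ∣ q ℚ.- r ∣ ℚ.< δ → ∣ p ℚ.- r ∣ ℚ.< ε
  chain-close {δ} p q r refl pδ qδ = begin-strict
    ∣ p ℚ.- r ∣
      ≡⟨ cong ∣_∣ (telescope p q r) ⟩
    ∣ (p ℚ.- q) ℚ.+ (q ℚ.- r) ∣      ≤⟨ ℚ.∣p+q∣≤∣p∣+∣q∣ (p ℚ.- q) (q ℚ.- r) ⟩
    ∣ p ℚ.- q ∣ ℚ.+ ∣ q ℚ.- r ∣      <⟨ ℚ.+-mono-< pδ qδ ⟩
    δ ℚ.+ δ                          ∎
    where open ℚ.≤-Reasoning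

  scaled : ∀ {B δ} p q → 0ℚ ℚ.< B → ∣ p ∣ ℚ.≤ B → ∣ q ∣ ℚ.< δ →
           ∣ p ℚ.* q ∣ ℚ.< B ℚ.* δ
  scaled {B} {δ} p q 0<B p≤B q<δ = begin-strict
    ∣ p ℚ.* q ∣      ≡⟨ ℚ.∣p*q∣≡∣p∣*∣q∣ p q ⟩
    ∣ p ∣ ℚ.* ∣ q ∣  ≤⟨ ℚ.*-monoʳ-≤-nonNeg ∣ q ∣ {{ℚ.∣-∣-nonNeg q}} p≤B ⟩
    B ℚ.* ∣ q ∣      <⟨ ℚ.*-monoʳ-<-pos B {{ℚ.positive 0<B}} q<δ ⟩
    B ℚ.* δ          ∎
    where open ℚ.≤-Reasoning

  product-close : ∀ {B C δ δ′ η ε} p q p′ q′ → η ℚ.+ η ≡ ε →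
                  0ℚ ℚ.< B → B ℚ.* δ ≡ η → ∣ p ∣ ℚ.≤ B → ∣ q ℚ.- q′ ∣ ℚ.< δ →
                  0ℚ ℚ.< C → C ℚ.* δ′ ≡ η → ∣ q′ ∣ ℚ.≤ C → ∣ p ℚ.- p′ ∣ ℚ.< δ′ →
                  ∣ p ℚ.* q ℚ.- p′ ℚ.* q′ ∣ ℚ.< ε
  product-close {η = η} p q p′ q′ refl 0<B Bδ p≤B qδ 0<C Cδ q≤C pδ = begin-strict
    ∣ p ℚ.* q ℚ.- p′ ℚ.* q′ ∣
      ≡⟨ cong ∣_∣ (product-diff p q p′ q′) ⟩
    ∣ p ℚ.* (q ℚ.- q′) ℚ.+ q′ ℚ.* (p ℚ.- p′) ∣
      ≤⟨ ℚ.∣p+q∣≤∣p∣+∣q∣ (p ℚ.* (q ℚ.- q′)) (q′ ℚ.* (p ℚ.- p′)) ⟩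
    ∣ p ℚ.* (q ℚ.- q′) ∣ ℚ.+ ∣ q′ ℚ.* (p ℚ.- p′) ∣
      <⟨ ℚ.+-mono-< (subst (_ ℚ.<_) Bδ (scaled p (q ℚ.- q′) 0<B p≤B qδ))
                    (subst (_ ℚ.<_) Cδ (scaled q′ (p ℚ.- p′) 0<C q≤C pδ)) ⟩
    η ℚ.+ η ∎
    where open ℚ.≤-Reasoning

  bounded : ∀ x → ∃ λ B → 0ℚ ℚ.< B × ∃ λ N → ∀ n → N ℕ.≤ n → ∣ seq x n ∣ ℚ.≤ B
  bounded x with cauchy x 1ℚ 0<1
  ... | N , near = 1ℚ ℚ.+ ∣ seq x N ∣ , 0<B , N , bound
    where
    open ℚ.≤-Reasoning
    0<B : 0ℚ ℚ.< 1ℚ ℚ.+ ∣ seq x N ∣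
    0<B = ℚ.+-mono-<-≤ 0<1 (ℚ.0≤∣p∣ (seq x N))
    bound : ∀ n → N ℕ.≤ n → ∣ seq x n ∣ ℚ.≤ 1ℚ ℚ.+ ∣ seq x N ∣
    bound n N≤n = begin
      ∣ seq x n ∣
        ≡⟨ cong ∣_∣ (add-back (seq x n) (seq x N)) ⟩
      ∣ (seq x n ℚ.- seq x N) ℚ.+ seq x N ∣
        ≤⟨ ℚ.∣p+q∣≤∣p∣+∣q∣ (seq x n ℚ.- seq x N) (seq x N) ⟩
      ∣ seq x n ℚ.- seq x N ∣ ℚ.+ ∣ seq x N ∣
        ≤⟨ ℚ.+-monoˡ-≤ ∣ seq x N ∣ (ℚ.<⇒≤ (near n N N≤n ℕ.≤-refl)) ⟩
      1ℚ ℚ.+ ∣ seq x N ∣ ∎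

  ⊔ˡ : ∀ {a b n} → a ⊔ b ℕ.≤ n → a ℕ.≤ n
  ⊔ˡ {a} {b} = ℕ.m⊔n≤o⇒m≤o a b

  ⊔ʳ : ∀ {a b n} → a ⊔ b ℕ.≤ n → b ℕ.≤ n
  ⊔ʳ {a} {b} = ℕ.m⊔n≤o⇒n≤o a b

fromℚ : ℚ → ℝ
seq    (fromℚ p) _     = p
cauchy (fromℚ p) ε 0<ε = 0 , λ _ _ _ _ → subst (ℚ._< ε) (sym (∣p-p∣≡0 p)) 0<ε

0ℝ 1ℝ : ℝ
0ℝ = fromℚ 0ℚ
1ℝ = fromℚ 1ℚ

infix  8 -_
infixl 7 _*_
infixl 6 _+_

_+_ : ℝ → ℝ → ℝ
seq    (x + y) n = seq x n ℚ.+ seq y n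
cauchy (x + y) ε 0<ε =
  let δ , 0<δ , eq = half ε 0<ε
      M , nearˣ    = cauchy x δ 0<δ
      N , nearʸ    = cauchy y δ 0<δ
  in M ⊔ N , λ m n m≥ n≥ →
       sum-close (seq x m) (seq y m) (seq x n) (seq y n) eq
         (nearˣ m n (⊔ˡ m≥) (⊔ˡ n≥)) (nearʸ m n (⊔ʳ {M} m≥) (⊔ʳ {M} n≥))

-_ : ℝ → ℝ
seq    (- x) n = ℚ.- seq x n
cauchy (- x) ε 0<ε =
  let N , near = cauchy x ε 0<ε
  in N , λ m n m≥ n≥ → neg-close (seq x m) (seq x n) (near m n m≥ n≥)

_*_ : ℝ → ℝ → ℝ
seq    (x * y) n = seq x n ℚ.* seq y n
cauchy (x * y) ε 0<ε =
  let η  , 0<η  , eq      = half ε 0<ε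
      B  , 0<B  , M , x≤B = bounded x
      C  , 0<C  , N , y≤C = bounded y
      δ  , 0<δ  , Bδ      = divide B 0<B η 0<η
      δ′ , 0<δ′ , Cδ      = divide C 0<C η 0<η
      K  , nearʸ          = cauchy y δ 0<δ
      L  , nearˣ          = cauchy x δ′ 0<δ′
  in (M ⊔ N) ⊔ (K ⊔ L) , λ m n m≥ n≥ →
       product-close (seq x m) (seq y m) (seq x n) (seq y n) eq
         0<B Bδ (x≤B m (⊔ˡ (⊔ˡ m≥)))
         (nearʸ m n (⊔ˡ (⊔ʳ {M ⊔ N} m≥)) (⊔ˡ (⊔ʳ {M ⊔ N} n≥)))
         0<C Cδ (y≤C n (⊔ʳ {M} (⊔ˡ n≥)))
         (nearˣ m n (⊔ʳ {K} (⊔ʳ {M ⊔ N} m≥)) (⊔ʳ {K} (⊔ʳ {M ⊔ N} n≥)))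

private
  pointwise : ∀ {x y} → (∀ n → seq x n ≡ seq y n) → x ≈ y
  pointwise {x} {y} eq = mk≈ λ ε 0<ε → 0 , λ n _ → subst (ℚ._< ε)
    (sym (trans (cong (λ p → ∣ p ℚ.- seq y n ∣) (eq n)) (∣p-p∣≡0 (seq y n)))) 0<ε

  ≈-refl : ∀ {x} → x ≈ x
  ≈-refl = pointwise λ _ → refl

  ≈-sym : ∀ {x y} → x ≈ y → y ≈ x
  ≈-sym {x} {y} x≈y = mk≈ λ ε 0<ε → let N , near = close x≈y ε 0<ε in
    N , λ n n≥ → subst (ℚ._< ε) (∣p-q∣≡∣q-p∣ (seq x n) (seq y n)) (near n n≥)

  ≈-trans : ∀ {x y z} → x ≈ y → y ≈ z → x ≈ z
  ≈-trans {x} {y} {z} x≈y y≈z = mk≈ λ ε 0<ε →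
    let δ , 0<δ , eq = half ε 0<ε
        M , near     = close x≈y δ 0<δ
        N , near′    = close y≈z δ 0<δ
    in M ⊔ N , λ n n≥ → chain-close (seq x n) (seq y n) (seq z n) eq
         (near n (⊔ˡ n≥)) (near′ n (⊔ʳ {M} n≥))

  +-cong : ∀ {x y u v} → x ≈ y → u ≈ v → x + u ≈ y + v
  +-cong {x} {y} {u} {v} x≈y u≈v = mk≈ λ ε 0<ε →
    let δ , 0<δ , eq = half ε 0<ε
        M , near     = close x≈y δ 0<δ
        N , near′    = close u≈v δ 0<δ
    in M ⊔ N , λ n n≥ → sum-close (seq x n) (seq u n) (seq y n) (seq v n) eq
         (near n (⊔ˡ n≥)) (near′ n (⊔ʳ {M} n≥))

  -‿cong : ∀ {x y} → x ≈ y → - x ≈ - y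
  -‿cong {x} {y} x≈y = mk≈ λ ε 0<ε → let N , near = close x≈y ε 0<ε in
    N , λ n n≥ → neg-close (seq x n) (seq y n) (near n n≥)

  *-cong : ∀ {x y u v} → x ≈ y → u ≈ v → x * u ≈ y * v
  *-cong {x} {y} {u} {v} x≈y u≈v = mk≈ λ ε 0<ε →
    let η  , 0<η  , eq      = half ε 0<ε
        B  , 0<B  , M , x≤B = bounded x
        C  , 0<C  , N , v≤C = bounded v
        δ  , 0<δ  , Bδ      = divide B 0<B η 0<η
        δ′ , 0<δ′ , Cδ      = divide C 0<C η 0<η
        K  , near           = close u≈v δ 0<δ
        L  , near′          = close x≈y δ′ 0<δ′
    in (M ⊔ N) ⊔ (K ⊔ L) , λ n n≥ →
         product-close (seq x n) (seq u n) (seq y n) (seq v n) eq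
           0<B Bδ (x≤B n (⊔ˡ (⊔ˡ n≥))) (near n (⊔ˡ (⊔ʳ {M ⊔ N} n≥)))
           0<C Cδ (v≤C n (⊔ʳ {M} (⊔ˡ n≥))) (near′ n (⊔ʳ {K} (⊔ʳ {M ⊔ N} n≥)))

ℝ-isCommutativeRing : IsCommutativeRing _≈_ _+_ _*_ -_ 0ℝ 1ℝ
ℝ-isCommutativeRing = record
  { isRing = record
    { +-isAbelianGroup = record
      { isGroup = record
        { isMonoid = record
          { isSemigroup = record
            { isMagma = record
              { isEquivalence = record
                { refl = ≈-refl ; sym = ≈-sym ; trans = ≈-trans }
              ; ∙-cong = +-cong
              }
            ; assoc = λ x y z → pointwise λ n → ℚ.+-assoc (seq x n) (seq y n) (seq z n)
            }
          ; identity = (λ x → pointwise λ n → ℚ.+-identityˡ (seq x n))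
                     , (λ x → pointwise λ n → ℚ.+-identityʳ (seq x n))
          }
        ; inverse = (λ x → pointwise λ n → ℚ.+-inverseˡ (seq x n))
                  , (λ x → pointwise λ n → ℚ.+-inverseʳ (seq x n))
        ; ⁻¹-cong = -‿cong
        }
      ; comm = λ x y → pointwise λ n → ℚ.+-comm (seq x n) (seq y n)
      }
    ; *-cong = *-cong
    ; *-assoc = λ x y z → pointwise λ n → ℚ.*-assoc (seq x n) (seq y n) (seq z n)
    ; *-identity = (λ x → pointwise λ n → ℚ.*-identityˡ (seq x n))
                 , (λ x → pointwise λ n → ℚ.*-identityʳ (seq x n))
    ; distrib = (λ x y z → pointwise λ n → ℚ.*-distribˡ-+ (seq x n) (seq y n) (seq z n))
              , (λ x y z → pointwise λ n → ℚ.*-distribʳ-+ (seq x n) (seq y n) (seq z n))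
    }
  ; *-comm = λ x y → pointwise λ n → ℚ.*-comm (seq x n) (seq y n)
  }

ℝ-commutativeRing : CommutativeRing 0ℓ 0ℓ
ℝ-commutativeRing = record { isCommutativeRing = ℝ-isCommutativeRing }

2ℝ : ℝ
2ℝ = 1ℝ + 1ℝ

------------------------------------------------------------------------
-- Linear algebra over ℝ

private
  module ℝ-Sum =
    CommutativeMonoidSum (CommutativeRing.+-commutativeMonoid ℝ-commutativeRing)
  module Sign-Sum = CommutativeMonoidSum Sign.*-commutativeMonoid

Matrix : ℕ → ℕ → Set
Matrix m n = Fin m → Fin n → ℝ

column : ∀ {m n} → Matrix m n → Fin n → Vector ℝ m
column M j i = M i j

lincomb : ∀ {m k} → (Fin k → ℝ) → (Fin k → Vector ℝ m) → Vector ℝ m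
lincomb c v i = ℝ-Sum.sum (λ k → c k * v k i)

InSpan : ∀ {m k} → (Fin k → Vector ℝ m) → Vector ℝ m → Set
InSpan v w = ∃ λ c → ∀ i → w i ≈ lincomb c v i

LinearlyIndependent : ∀ {m k} → (Fin k → Vector ℝ m) → Set
LinearlyIndependent v = ∀ c → (∀ i → lincomb c v i ≈ 0ℝ) → ∀ k → c k ≈ 0ℝ

-- The rank is the dimension of the column space.  It is a relation rather
-- than a function because equality of reals is not decidable.
record HasRank {m n} (M : Matrix m n) (r : ℕ) : Set where
  field
    basis         : Fin r → Vector ℝ m
    inColumnSpace : ∀ k → InSpan (column M) (basis k)
    independent   : LinearlyIndependent basis
    spanning      : ∀ w → InSpan (column M) w → InSpan basis w

identityMatrix : ∀ n → Matrix n n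
identityMatrix n i j = if does (i Fin.≟ j) then 1ℝ else 0ℝ

------------------------------------------------------------------------
-- Graphs and girth

record Graph (n : ℕ) : Set₁ where
  field
    Adj         : Rel (Fin n) 0ℓ
    adj?        : Decidable Adj
    symmetric   : Symmetric Adj
    irreflexive : Irreflexive _≡_ Adj

-- i ↦ i + 1 modulo n
next : ∀ {n} → Fin n → Fin n
next {suc n} i = suc (toℕ i) mod suc n

record Cycle {n} (G : Graph n) (l : ℕ) : Set where
  open Graph G
  field
    3≤length  : 3 ℕ.≤ l
    vertex    : Fin l → Fin n
    injective : Injective _≡_ _≡_ vertex
    adjacent  : ∀ i → Adj (vertex i) (vertex (next i))

IsGirth : ∀ {n} → Graph n → ℕ → Set
IsGirth G g = Cycle G g × (∀ {l} → Cycle G l → g ℕ.≤ l)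

-- An isomorphism from Cₙ, whose vertices are those of Fin n with i joined
-- to i ± 1 modulo n.
record IsCycleGraph {n} (G : Graph n) : Set where
  open Graph G
  field
    labelling : Permutation′ n
    adjacency : ∀ i j → Adj (labelling ⟨$⟩ʳ i) (labelling ⟨$⟩ʳ j)
                        ⇔ (j ≡ next i ⊎ i ≡ next j)

------------------------------------------------------------------------
-- Signed graphs

-- Only the values of σ on adjacent pairs are meaningful.
record SignedGraph (n : ℕ) : Set₁ where
  field
    graph : Graph n
  open Graph graph public
  field
    σ     : Fin n → Fin n → Sign
    σ-sym : ∀ {i j} → Adj i j → σ i j ≡ σ j i

signToℝ : Sign → ℝ
signToℝ Sign.+ = 1ℝ
signToℝ Sign.- = - 1ℝ

adjacencyMatrix : ∀ {n} → SignedGraph n → Matrix n n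
adjacencyMatrix G i j = if does (adj? i j) then signToℝ (σ i j) else 0ℝ
  where open SignedGraph G

characteristicMatrix : ∀ {n} → SignedGraph n → ℝ → Matrix n n
characteristicMatrix {n} G x i j =
  x * identityMatrix n i j + - adjacencyMatrix G i j

-- m(G, x) = k, i.e. k = n - rank (x I - A(G))
HasMultiplicity : ∀ {n} → SignedGraph n → ℝ → ℕ → Set
HasMultiplicity {n} G x k =
  ∃ λ r → HasRank (characteristicMatrix G x) r × k ℕ.+ r ≡ n

record SignedCycle (n : ℕ) : Set₁ where
  field
    signedGraph  : SignedGraph n
  open SignedGraph signedGraph public
  field
    isCycleGraph : IsCycleGraph graph
  open IsCycleGraph isCycleGraph public

  -- For n ≥ 3 the edges are vᵢvᵢ₊₁ with i modulo n, each occurring once.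
  signProduct : Sign
  signProduct = Sign-Sum.sum λ i → σ (labelling ⟨$⟩ʳ i) (labelling ⟨$⟩ʳ next i)

Balanced : ∀ {n} → SignedCycle n → Set
Balanced C = SignedCycle.signProduct C ≡ Sign.+

Unbalanced : ∀ {n} → SignedCycle n → Set
Unbalanced C = ¬ Balanced C

{-# OPTIONS --safe #-}
module Submission where

-- Let T be the signed shift (T h)(v) = σ(v, νv) h(νv), where ν is the rotation
-- of the cycle.  T is orthogonal, the adjacency matrix is T + T⁻¹, and Tⁿ is the
-- product ε of all signs.
--
-- If x I − A has rank n − 1, its kernel is a line spanned by some f, and T maps
-- the kernel to itself.  As T is an isometry, T f = c f with c = ±1.  Hence
-- x = 2c, and going once around the cycle gives cⁿ ε = 1.  Conversely, if
-- cⁿ ε = 1 then some f with values ±1 satisfies T f = c f, and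
-- (2c − T − T⁻¹) h = 0 forces T h = c h, so h is determined by its value at one
-- vertex: the columns of 2c I − A at the other vertices form a basis of the
-- column space.
--
-- Equality of reals is stable but not decidable, so the first direction runs
-- under double negation; it ends with a choice between two stable statements,
-- made by looking at a rational approximation of x.

open import Defs
open import Algebra.Bundles using (CommutativeRing)
import Algebra.Properties.CommutativeMonoid.Sum as CommutativeMonoidSum
import Algebra.Properties.CommutativeSemigroup as CommutativeSemigroupProperties
open import Algebra.Solver.Ring.AlmostCommutativeRing
  using (fromCommutativeRing; _-Raw-AlmostCommutative⟶_)
import Algebra.Solver.Ring as RingSolver
open import Data.Bool.Base using (if_then_else_)
open import Data.Fin.Base using (Fin; zero; suc; toℕ; fromℕ; fromℕ<; inject₁; punchIn)
open import Data.Fin.Induction using (<-weakInduction; >-weakInduction)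
open import Data.Fin.Permutation
  using (Permutation′; permutation; _⟨$⟩ʳ_; _⟨$⟩ˡ_; inverseˡ; inverseʳ; flip; _∘ₚ_)
import Data.Fin.Properties as Fin
open import Data.Fin.Relation.Unary.Top using (view; ‵fromℕ; ‵inject₁)
import Data.Maybe.Base as Maybe
open import Data.Nat.Base as ℕ using (ℕ; _≤_; _∸_; zero; suc; _⊔_; z≤n; s≤s)
open import Data.Nat.Divisibility.Core using (_∣_)
import Data.Nat.Divisibility as ℕ
open import Data.Nat.DivMod using (m<n⇒m%n≡m; n%n≡0; m%n<n)
import Data.Nat.Properties as ℕ
open import Data.Product.Base using (∃; ∃₂; _×_; _,_; proj₁; proj₂)
open import Data.Rational.Base as ℚ using (ℚ; 0ℚ; 1ℚ; ½) renaming (∣_∣ to ∥_∥)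
import Data.Rational.Properties as ℚ
open import Data.Rational.Solver using (module +-*-Solver)
open import Data.Sign.Base as Sign using (Sign)
import Data.Sign.Properties as Sign
open import Data.Sum.Base using (_⊎_; inj₁; inj₂)
open import Data.Vec.Functional using (Vector; _∷_; insertAt; removeAt)
open import Data.Vec.Functional.Properties using (insertAt-lookup; insertAt-punchIn)
open import Function.Base using (_∘_)
open import Function.Bundles using (_⇔_; mk⇔; Equivalence)
open import Function.Construct.Composition using (_⇔-∘_)
open import Relation.Binary.PropositionalEquality as ≡ using (_≡_; _≢_)
open import Relation.Nullary.Decidable.Core
  using (does; yes; no; dec⇒maybe; decidable-stable; ¬¬-excluded-middle)
open import Relation.Nullary.Negation.Core using (¬_; contradiction)
open import Relation.Unary using (Pred)

open CommutativeRing ℝ-commutativeRing using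
  ( refl; sym; trans; reflexive; setoid; semiring; -‿cong; -‿inverseʳ; zeroˡ; zeroʳ
  ; +-cong; +-congˡ; +-congʳ; +-comm; +-identityˡ; +-identityʳ
  ; *-cong; *-congˡ; *-congʳ; *-comm; *-assoc; *-identityˡ; *-identityʳ )
open CommutativeMonoidSum Sign.*-commutativeMonoid using ()
  renaming (sum to product; sum-cong-≗ to product-cong; ∑-distrib-+ to product-*
           ; sum-replicate-zero to product-+)

-- Real numbers

module _ where
  open +-*-Solver

  ½p+½p≡p : ∀ p → ½ ℚ.* p ℚ.+ ½ ℚ.* p ≡ p
  ½p+½p≡p = solve 1 (λ p → con ½ :* p :+ con ½ :* p := p) ≡.refl

  p≡p-q+q : ∀ p q → p ≡ (p ℚ.- q) ℚ.+ q
  p≡p-q+q = solve 2 (λ p q → p := (p :- q) :+ q) ≡.refl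

  -p*-p≡p*p : ∀ p → (ℚ.- p) ℚ.* (ℚ.- p) ≡ p ℚ.* p
  -p*-p≡p*p = solve 1 (λ p → (:- p) :* (:- p) := p :* p) ≡.refl

  q-p≡-p--q : ∀ p q → q ℚ.- p ≡ (ℚ.- p) ℚ.- (ℚ.- q)
  q-p≡-p--q = solve 2 (λ p q → q :- p := (:- p) :- (:- q)) ≡.refl

seq-≡⇒≈ : ∀ {x y} → (∀ n → seq x n ≡ seq y n) → x ≈ y
seq-≡⇒≈ {x} {y} eq = mk≈ λ ε 0<ε → 0 , λ n _ → ≡.subst (ℚ._< ε)
  (≡.cong ∥_∥ (≡.sym (≡.trans (≡.cong (ℚ._- seq y n) (eq n)) (ℚ.+-inverseʳ (seq y n))))) 0<ε

fromℚ-cong : ∀ {p q} → p ≡ q → fromℚ p ≈ fromℚ q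
fromℚ-cong ≡.refl = refl

fromℚ-homomorphism : CommutativeRing.rawRing ℚ.+-*-commutativeRing
                     -Raw-AlmostCommutative⟶ fromCommutativeRing ℝ-commutativeRing
fromℚ-homomorphism = record
  { ⟦_⟧    = fromℚ
  ; +-homo = λ _ _ → seq-≡⇒≈ λ _ → ≡.refl
  ; *-homo = λ _ _ → seq-≡⇒≈ λ _ → ≡.refl
  ; -‿homo = λ _ → seq-≡⇒≈ λ _ → ≡.refl
  ; 0-homo = refl
  ; 1-homo = refl
  }

-- Rational coefficients give the solver decidable equality of coefficients, which the reals lack,
-- and make constants such as ½ available.
module ℝSolver = RingSolver (CommutativeRing.rawRing ℚ.+-*-commutativeRing)
  (fromCommutativeRing ℝ-commutativeRing) fromℚ-homomorphism
  (λ p q → Maybe.map fromℚ-cong (dec⇒maybe (p ℚ.≟ q)))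
open ℝSolver

x-y≈0⇒x≈y : ∀ {x y} → x + - y ≈ 0ℝ → x ≈ y
x-y≈0⇒x≈y {x} {y} eq = trans (solve 2 (λ x y → x := (x :- y) :+ y) refl x y)
  (trans (+-congʳ eq) (+-identityˡ y))

x≈y⇒x-y≈0 : ∀ {x y} → x ≈ y → x + - y ≈ 0ℝ
x≈y⇒x-y≈0 {x} {y} eq = trans (+-congʳ eq) (-‿inverseʳ y)

-- Convergence to 0, apartness and stability of equality

close-to-0 : ∀ {x} → x ≈ 0ℝ → ∀ ε → 0ℚ ℚ.< ε → ∃ λ N → ∀ n → N ≤ n → ∥ seq x n ∥ ℚ.< ε
close-to-0 {x} x≈0 ε 0<ε = let N , near = close x≈0 ε 0<ε in
  N , λ n N≤n → ≡.subst (λ p → ∥ p ∥ ℚ.< ε) (ℚ.+-identityʳ (seq x n)) (near n N≤n)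

≈0-intro : ∀ {x} → (∀ ε → 0ℚ ℚ.< ε → ∃ λ N → ∀ n → N ≤ n → ∥ seq x n ∥ ℚ.< ε) → x ≈ 0ℝ
≈0-intro {x} small = mk≈ λ ε 0<ε → let N , near = small ε 0<ε in
  N , λ n N≤n → ≡.subst (λ p → ∥ p ∥ ℚ.< ε) (≡.sym (ℚ.+-identityʳ (seq x n))) (near n N≤n)

squeeze : ∀ {x y} N → (∀ n → N ≤ n → ∥ seq x n ∥ ℚ.≤ ∥ seq y n ∥) → y ≈ 0ℝ → x ≈ 0ℝ
squeeze N x≤y y≈0 = ≈0-intro λ ε 0<ε → let M , near = close-to-0 y≈0 ε 0<ε in
  M ⊔ N , λ n ≥ → ℚ.≤-<-trans (x≤y n (ℕ.m⊔n≤o⇒n≤o M N ≥)) (near n (ℕ.m⊔n≤o⇒m≤o M N ≥))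

halve : ∀ ε → 0ℚ ℚ.< ε → 0ℚ ℚ.< ½ ℚ.* ε × ½ ℚ.* ε ℚ.+ ½ ℚ.* ε ≡ ε
halve ε 0<ε = ℚ.*-monoʳ-<-pos ½ 0<ε , ½p+½p≡p ε

-- The positive form of being nonzero (apartness from 0). The explicit bound ε is what makes
-- cancellation possible without inverting a real.
BoundedAwayFrom0 : ℝ → Set
BoundedAwayFrom0 x = ∃ λ ε → 0ℚ ℚ.< ε × ∃ λ N → ∀ n → N ≤ n → ε ℚ.≤ ∥ seq x n ∥

boundedAway⇒≉0 : ∀ {x} → BoundedAwayFrom0 x → ¬ x ≈ 0ℝ
boundedAway⇒≉0 (ε , 0<ε , N , far) x≈0 = let M , near = close-to-0 x≈0 ε 0<ε in
  ℚ.<-irrefl ≡.refl (ℚ.<-≤-trans (near (M ⊔ N) (ℕ.m≤m⊔n M N)) (far (M ⊔ N) (ℕ.m≤n⊔m M N)))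

∣p∣≤∣p-q∣+∣q∣ : ∀ p q → ∥ p ∥ ℚ.≤ ∥ p ℚ.- q ∥ ℚ.+ ∥ q ∥
∣p∣≤∣p-q∣+∣q∣ p q = begin
  ∥ p ∥                    ≡⟨ ≡.cong ∥_∥ (p≡p-q+q p q) ⟩
  ∥ (p ℚ.- q) ℚ.+ q ∥      ≤⟨ ℚ.∣p+q∣≤∣p∣+∣q∣ (p ℚ.- q) q ⟩
  ∥ p ℚ.- q ∥ ℚ.+ ∥ q ∥    ∎
  where open ℚ.≤-Reasoning

-- Choose N beyond which terms differ by less than ε/4 and compare the rational |x_N| with ε/2. If
-- it is at least ε/2, all later terms stay at least ε/4, which is excluded; otherwise all later
-- terms are below ε.
¬boundedAway⇒≈0 : ∀ {x} → ¬ BoundedAwayFrom0 x → x ≈ 0ℝ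
¬boundedAway⇒≈0 {x} ¬away = ≈0-intro λ ε 0<ε →
  let 0<δ , δ+δ≡ε = halve ε 0<ε
      0<η , η+η≡δ = halve (½ ℚ.* ε) 0<δ
      N   , near  = cauchy x (½ ℚ.* (½ ℚ.* ε)) 0<η
  in N , bound 0<η η+η≡δ δ+δ≡ε near
  where
  open ℚ.≤-Reasoning
  module _ {η δ ε N} (0<η : 0ℚ ℚ.< η) (η+η≡δ : η ℚ.+ η ≡ δ) (δ+δ≡ε : δ ℚ.+ δ ≡ ε)
           (near : ∀ m n → N ≤ m → N ≤ n → ∥ seq x m ℚ.- seq x n ∥ ℚ.< η) where
    η<δ : η ℚ.< δ
    η<δ = begin-strict
      η          ≡⟨ ℚ.+-identityʳ η ⟨
      η ℚ.+ 0ℚ   <⟨ ℚ.+-monoʳ-< η 0<η ⟩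
      η ℚ.+ η    ≡⟨ η+η≡δ ⟩
      δ          ∎
    far : δ ℚ.≤ ∥ seq x N ∥ → ∀ n → N ≤ n → η ℚ.≤ ∥ seq x n ∥
    far δ≤x n N≤n = ℚ.≮⇒≥ λ x<η → ℚ.<-irrefl ≡.refl (begin-strict
      δ                                        ≤⟨ δ≤x ⟩
      ∥ seq x N ∥                              ≤⟨ ∣p∣≤∣p-q∣+∣q∣ (seq x N) (seq x n) ⟩
      ∥ seq x N ℚ.- seq x n ∥ ℚ.+ ∥ seq x n ∥  <⟨ ℚ.+-mono-< (near N n ℕ.≤-refl N≤n) x<η ⟩
      η ℚ.+ η                                  ≡⟨ η+η≡δ ⟩
      δ                                        ∎)
    bound : ∀ n → N ≤ n → ∥ seq x n ∥ ℚ.< ε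
    bound n N≤n with ∥ seq x N ∥ ℚ.<? δ
    ... | no  x≮δ = contradiction (η , 0<η , N , far (ℚ.≮⇒≥ x≮δ)) ¬away
    ... | yes x<δ = begin-strict
      ∥ seq x n ∥                              ≤⟨ ∣p∣≤∣p-q∣+∣q∣ (seq x n) (seq x N) ⟩
      ∥ seq x n ℚ.- seq x N ∥ ℚ.+ ∥ seq x N ∥  <⟨ ℚ.+-mono-< (ℚ.<-trans (near n N N≤n ℕ.≤-refl) η<δ) x<δ ⟩
      δ ℚ.+ δ                                  ≡⟨ δ+δ≡ε ⟩
      ε                                        ∎

-- Vanishing is equivalent to a negation, namely of `BoundedAwayFrom0`. This is what discharges the
-- classical case distinctions made under double negation.
≈0-stable : ∀ {x} → ¬ ¬ x ≈ 0ℝ → x ≈ 0ℝ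
≈0-stable ¬¬x≈0 = ¬boundedAway⇒≈0 λ away → ¬¬x≈0 (boundedAway⇒≉0 away)

≈-stable : ∀ {x y} → ¬ ¬ x ≈ y → x ≈ y
≈-stable ¬¬x≈y = x-y≈0⇒x≈y (≈0-stable λ ≉0 → ¬¬x≈y (≉0 ∘ x≈y⇒x-y≈0))

-- Eventually |ε y_n| ≤ |x_n y_n|, so ε y tends to 0, and only the rational ε has to be inverted.
boundedAway-cancelˡ : ∀ {x y} → BoundedAwayFrom0 x → x * y ≈ 0ℝ → y ≈ 0ℝ
boundedAway-cancelˡ {x} {y} (ε , 0<ε , N , far) xy≈0 = begin
  y                            ≈⟨ *-identityˡ y ⟨
  1ℝ * y                       ≈⟨ *-congʳ (fromℚ-cong (ℚ.*-inverseˡ ε)) ⟨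
  fromℚ (ℚ.1/ ε ℚ.* ε) * y     ≈⟨ seq-≡⇒≈ (λ n → ℚ.*-assoc (ℚ.1/ ε) ε (seq y n)) ⟩
  fromℚ (ℚ.1/ ε) * (fromℚ ε * y)  ≈⟨ *-congˡ (squeeze N scaled xy≈0) ⟩
  fromℚ (ℚ.1/ ε) * 0ℝ          ≈⟨ zeroʳ (fromℚ (ℚ.1/ ε)) ⟩
  0ℝ                           ∎
  where
  open import Relation.Binary.Reasoning.Setoid setoid
  instance
    _ = ℚ.positive 0<ε
    _ = ℚ.pos⇒nonZero ε
  scaled : ∀ n → N ≤ n → ∥ ε ℚ.* seq y n ∥ ℚ.≤ ∥ seq x n ℚ.* seq y n ∥
  scaled n N≤n = ≤.begin
    ∥ ε ℚ.* seq y n ∥            ≤.≡⟨ ℚ.∣p*q∣≡∣p∣*∣q∣ ε (seq y n) ⟩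
    ∥ ε ∥ ℚ.* ∥ seq y n ∥        ≤.≡⟨ ≡.cong (ℚ._* ∥ seq y n ∥) (ℚ.0≤p⇒∣p∣≡p (ℚ.<⇒≤ 0<ε)) ⟩
    ε ℚ.* ∥ seq y n ∥            ≤.≤⟨ ℚ.*-monoʳ-≤-nonNeg ∥ seq y n ∥ {{ℚ.∣-∣-nonNeg (seq y n)}} (far n N≤n) ⟩
    ∥ seq x n ∥ ℚ.* ∥ seq y n ∥  ≤.≡⟨ ℚ.∣p*q∣≡∣p∣*∣q∣ (seq x n) (seq y n) ⟨
    ∥ seq x n ℚ.* seq y n ∥      ≤.∎
    where module ≤ = ℚ.≤-Reasoning

-- The hypothesis yields no explicit bound away from 0, but the conclusion is stable, so a bound may
-- be assumed.
*-cancelˡ-≉0 : ∀ {x y} → ¬ x ≈ 0ℝ → x * y ≈ 0ℝ → y ≈ 0ℝ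
*-cancelˡ-≉0 x≉0 xy≈0 = ≈0-stable λ y≉0 →
  x≉0 (¬boundedAway⇒≈0 λ away → y≉0 (boundedAway-cancelˡ away xy≈0))

x²≈0⇒x≈0 : ∀ {x} → x * x ≈ 0ℝ → x ≈ 0ℝ
x²≈0⇒x≈0 x²≈0 = ≈0-stable λ x≉0 → x≉0 (*-cancelˡ-≉0 x≉0 x²≈0)

x+x≈0⇒x≈0 : ∀ {x} → x + x ≈ 0ℝ → x ≈ 0ℝ
x+x≈0⇒x≈0 {x} x+x≈0 = trans (solve 1 (λ x → x := con ½ :* (x :+ x)) refl x)
  (trans (*-congˡ x+x≈0) (zeroʳ (fromℚ ½)))

1≉0 : ¬ 1ℝ ≈ 0ℝ
1≉0 = boundedAway⇒≉0 (1ℚ , ℚ.positive⁻¹ 1ℚ , 0 , λ _ _ → ℚ.≤-refl)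

-- Not invariant under ≈, but sums of squares have it and it needs no ε.
TermwiseNonNegative : ℝ → Set
TermwiseNonNegative x = ∀ n → 0ℚ ℚ.≤ seq x n

∣p∣*∣p∣≡p*p : ∀ p → ∥ p ∥ ℚ.* ∥ p ∥ ≡ p ℚ.* p
∣p∣*∣p∣≡p*p p with ℚ.∣p∣≡p∨∣p∣≡-p p
... | inj₁ eq = ≡.cong₂ ℚ._*_ eq eq
... | inj₂ eq = ≡.trans (≡.cong₂ ℚ._*_ eq eq) (-p*-p≡p*p p)

square-nonNegative : ∀ x → TermwiseNonNegative (x * x)
square-nonNegative x n = ≡.subst (0ℚ ℚ.≤_) (≡.trans (ℚ.∣p*q∣≡∣p∣*∣q∣ p p) (∣p∣*∣p∣≡p*p p))
  (ℚ.0≤∣p∣ (p ℚ.* p))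
  where p = seq x n

nonNegative-+ : ∀ {x y} → TermwiseNonNegative x → TermwiseNonNegative y → TermwiseNonNegative (x + y)
nonNegative-+ 0≤x 0≤y n = ℚ.+-mono-≤ (0≤x n) (0≤y n)

x+y≈0⇒x≈0 : ∀ {x y} → TermwiseNonNegative x → TermwiseNonNegative y → x + y ≈ 0ℝ → x ≈ 0ℝ
x+y≈0⇒x≈0 {x} {y} 0≤x 0≤y = squeeze 0 λ n _ → begin
  ∥ seq x n ∥             ≡⟨ ℚ.0≤p⇒∣p∣≡p (0≤x n) ⟩
  seq x n                 ≡⟨ ℚ.+-identityʳ (seq x n) ⟨
  seq x n ℚ.+ 0ℚ          ≤⟨ ℚ.+-monoʳ-≤ (seq x n) (0≤y n) ⟩
  seq x n ℚ.+ seq y n     ≡⟨ ℚ.0≤p⇒∣p∣≡p (ℚ.+-mono-≤ (0≤x n) (0≤y n)) ⟨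
  ∥ seq x n ℚ.+ seq y n ∥ ∎
  where open ℚ.≤-Reasoning

eventually>-1⇒≉-2 : ∀ {x} N → (∀ n → N ≤ n → 0ℚ ℚ.< seq x n ℚ.+ 1ℚ) → ¬ x ≈ - 2ℝ
eventually>-1⇒≉-2 {x} N >-1 x≈-2 = boundedAway⇒≉0
  (1ℚ , ℚ.positive⁻¹ 1ℚ , N , λ n N≤n → let 0<x+1 = >-1 n N≤n in begin
    1ℚ                        ≡⟨ ℚ.+-identityˡ 1ℚ ⟨
    0ℚ ℚ.+ 1ℚ                 ≤⟨ ℚ.+-monoˡ-≤ 1ℚ (ℚ.<⇒≤ 0<x+1) ⟩
    seq x n ℚ.+ 1ℚ ℚ.+ 1ℚ     ≡⟨ ℚ.0≤p⇒∣p∣≡p (ℚ.+-mono-≤ (ℚ.<⇒≤ 0<x+1) (ℚ.<⇒≤ (ℚ.positive⁻¹ 1ℚ))) ⟨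
    ∥ seq x n ℚ.+ 1ℚ ℚ.+ 1ℚ ∥ ∎)
  (trans (solve 1 (λ x → x :+ con 1ℚ :+ con 1ℚ := x :- :- (con 1ℚ :+ con 1ℚ)) refl x)
         (x≈y⇒x-y≈0 x≈-2))
  where open ℚ.≤-Reasoning

p≤∣p∣ : ∀ p → p ℚ.≤ ∥ p ∥
p≤∣p∣ p with ℚ.≤-total 0ℚ p
... | inj₁ 0≤p = ℚ.≤-reflexive (≡.sym (ℚ.0≤p⇒∣p∣≡p 0≤p))
... | inj₂ p≤0 = ℚ.≤-trans p≤0 (ℚ.0≤∣p∣ p)

∣p-q∣<1⇒0<q+1 : ∀ p q → 0ℚ ℚ.≤ p → ∥ p ℚ.- q ∥ ℚ.< 1ℚ → 0ℚ ℚ.< q ℚ.+ 1ℚ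
∣p-q∣<1⇒0<q+1 p q 0≤p near = begin-strict
  0ℚ                   ≤⟨ 0≤p ⟩
  p                    ≡⟨ ≡.trans (p≡p-q+q p q) (ℚ.+-comm (p ℚ.- q) q) ⟩
  q ℚ.+ (p ℚ.- q)      ≤⟨ ℚ.+-monoʳ-≤ q (p≤∣p∣ (p ℚ.- q)) ⟩
  q ℚ.+ ∥ p ℚ.- q ∥    <⟨ ℚ.+-monoʳ-< q near ⟩
  q ℚ.+ 1ℚ             ∎
  where open ℚ.≤-Reasoning

-- Some rational term x_N is within 1 of all later terms, so its sign decides: if x_N ≥ 0 the later
-- terms exceed -1, far from -2; if x_N ≤ 0 the same argument applies to - x.
≉2⊎≉-2 : ∀ x → ¬ x ≈ 2ℝ ⊎ ¬ x ≈ - 2ℝ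
≉2⊎≉-2 x with cauchy x 1ℚ (ℚ.positive⁻¹ 1ℚ)
... | N , near with ℚ.≤-total 0ℚ (seq x N)
...   | inj₁ 0≤x = inj₂ (eventually>-1⇒≉-2 N λ n N≤n →
  ∣p-q∣<1⇒0<q+1 (seq x N) (seq x n) 0≤x (near N n ℕ.≤-refl N≤n))
...   | inj₂ x≤0 = inj₁ λ x≈2 → eventually>-1⇒≉-2 { - x } N (λ n N≤n →
  ∣p-q∣<1⇒0<q+1 (ℚ.- seq x N) (ℚ.- seq x n) (ℚ.neg-antimono-≤ x≤0)
    (≡.subst (λ p → ∥ p ∥ ℚ.< 1ℚ) (q-p≡-p--q (seq x N) (seq x n))
      (near n N N≤n ℕ.≤-refl))) (-‿cong x≈2)

signToℝ-* : ∀ s t → signToℝ (s Sign.* t) ≈ signToℝ s * signToℝ t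
signToℝ-* Sign.+ t      = sym (*-identityˡ (signToℝ t))
signToℝ-* Sign.- Sign.+ = sym (*-identityʳ (- 1ℝ))
signToℝ-* Sign.- Sign.- = solve 0 (con 1ℚ := (:- con 1ℚ) :* (:- con 1ℚ)) refl

signToℝ-square : ∀ s → signToℝ s * signToℝ s ≈ 1ℝ
signToℝ-square Sign.+ = *-identityˡ 1ℝ
signToℝ-square Sign.- = sym (signToℝ-* Sign.- Sign.-)

-- Cyclic order on Fin n

next-inject₁ : ∀ {m} (i : Fin m) → next (inject₁ i) ≡ suc i
next-inject₁ {m} i = Fin.toℕ-injective (begin
  toℕ (fromℕ< (m%n<n (suc (toℕ (inject₁ i))) (suc m)))
    ≡⟨ Fin.toℕ-fromℕ< (m%n<n (suc (toℕ (inject₁ i))) (suc m)) ⟩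
  suc (toℕ (inject₁ i)) ℕ.% suc m
    ≡⟨ ≡.cong (λ k → suc k ℕ.% suc m) (Fin.toℕ-inject₁ i) ⟩
  suc (toℕ i) ℕ.% suc m                                 ≡⟨ m<n⇒m%n≡m (s≤s (Fin.toℕ<n i)) ⟩
  suc (toℕ i)                                           ∎)
  where open ≡.≡-Reasoning

next-fromℕ : ∀ m → next (fromℕ m) ≡ zero
next-fromℕ m = Fin.toℕ-injective (begin
  toℕ (fromℕ< (m%n<n (suc (toℕ (fromℕ m))) (suc m)))
    ≡⟨ Fin.toℕ-fromℕ< (m%n<n (suc (toℕ (fromℕ m))) (suc m)) ⟩
  suc (toℕ (fromℕ m)) ℕ.% suc m
    ≡⟨ ≡.cong (λ k → suc k ℕ.% suc m) (Fin.toℕ-fromℕ m) ⟩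
  suc m ℕ.% suc m                                     ≡⟨ n%n≡0 (suc m) ⟩
  0                                                   ∎)
  where open ≡.≡-Reasoning

prev : ∀ {n} → Fin n → Fin n
prev {suc m} zero    = fromℕ m
prev {suc m} (suc i) = inject₁ i

next-prev : ∀ {n} (i : Fin n) → next (prev i) ≡ i
next-prev {suc m} zero    = next-fromℕ m
next-prev {suc m} (suc i) = next-inject₁ i

prev-next : ∀ {n} (i : Fin n) → prev (next i) ≡ i
prev-next {suc m} i with view i
... | ‵fromℕ     = ≡.cong prev (next-fromℕ m)
... | ‵inject₁ j = ≡.cong prev (next-inject₁ j)

rotation : ∀ {n} → Permutation′ n
rotation = permutation next prev next-prev prev-next

-- This is where length at least 3 enters: on two indices successor and predecessor coincide.
next≢prev : ∀ {n} → 3 ≤ n → (i : Fin n) → next i ≢ prev i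
next≢prev {suc (suc (suc m))} _ i eq with view i
... | ‵fromℕ = Fin.0≢1+n (≡.trans (≡.sym (next-fromℕ (suc (suc m)))) eq)
... | ‵inject₁ zero = Fin.0≢1+n (Fin.suc-injective eq)
... | ‵inject₁ (suc j) = ℕ.<⇒≢ (s≤s (ℕ.n≤1+n (toℕ j))) (≡.sym (begin
  suc (suc (toℕ j))                ≡⟨ ≡.cong toℕ (next-inject₁ (suc j)) ⟨
  toℕ (next (inject₁ (suc j)))     ≡⟨ ≡.cong toℕ eq ⟩
  toℕ (inject₁ (inject₁ j))        ≡⟨ Fin.toℕ-inject₁ (inject₁ j) ⟩
  toℕ (inject₁ j)                  ≡⟨ Fin.toℕ-inject₁ j ⟩
  toℕ j                            ∎))
  where open ≡.≡-Reasoning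
next≢prev {suc (suc zero)} (s≤s (s≤s ()))
next≢prev {suc zero} (s≤s ())

module _ {m p} (P : Pred (Fin (suc m)) p) (closed : ∀ i → P i → P (next i)) where

  next-closed-from-zero : P zero → ∀ i → P i
  next-closed-from-zero P0 = <-weakInduction P P0 λ i Pi →
    ≡.subst P (next-inject₁ i) (closed (inject₁ i) Pi)

  -- The rotation is transitive: climb from i to the last index, wrap around to zero, and climb
  -- again to j. The downward induction handles the first leg.
  next-closed : ∀ {i} → P i → ∀ j → P j
  next-closed {i} Pi = next-closed-from-zero (>-weakInduction (λ i → P i → P zero)
    (λ Plast → ≡.subst P (next-fromℕ m) (closed (fromℕ m) Plast))
    (λ i ih Pi → ih (≡.subst P (next-inject₁ i) (closed (inject₁ i) Pi))) i Pi)

-- Products of signs along the cyclic order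

partialProduct : ∀ {m} → (Fin m → Sign) → Fin (suc m) → Sign
partialProduct {m}     t zero    = Sign.+
partialProduct {suc m} t (suc i) = t zero Sign.* partialProduct (t ∘ suc) i

partialProduct-suc : ∀ {m} (t : Fin m → Sign) i →
                     partialProduct t (suc i) ≡ t i Sign.* partialProduct t (inject₁ i)
partialProduct-suc t zero    = ≡.refl
partialProduct-suc t (suc i) = begin
  t zero Sign.* partialProduct (t ∘ suc) (suc i)
    ≡⟨ ≡.cong (t zero Sign.*_) (partialProduct-suc (t ∘ suc) i) ⟩
  t zero Sign.* (t (suc i) Sign.* partialProduct (t ∘ suc) (inject₁ i))
    ≡⟨ x∙yz≈y∙xz (t zero) (t (suc i)) _ ⟩
  t (suc i) Sign.* (t zero Sign.* partialProduct (t ∘ suc) (inject₁ i))   ∎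
  where
  open ≡.≡-Reasoning
  open CommutativeSemigroupProperties Sign.*-commutativeSemigroup

partialProduct-fromℕ : ∀ m (t : Fin m → Sign) → partialProduct t (fromℕ m) ≡ product t
partialProduct-fromℕ zero    t = ≡.refl
partialProduct-fromℕ (suc m) t = ≡.cong (t zero Sign.*_) (partialProduct-fromℕ m (t ∘ suc))

module _ {m} (t : Fin (suc m) → Sign) where

  -- The solution, with value + at zero, of the recurrence h(i+1) = t(i) h(i) along the path from
  -- zero to the last index. The closing factor at the last index is left out.
  phase : Fin (suc m) → Sign
  phase i = partialProduct t (inject₁ i)

  phase-suc : ∀ i → phase (suc i) ≡ t (inject₁ i) Sign.* phase (inject₁ i)
  phase-suc i = partialProduct-suc t (inject₁ i)

  phase-fromℕ : t (fromℕ m) Sign.* phase (fromℕ m) ≡ product t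
  phase-fromℕ = ≡.trans (≡.sym (partialProduct-suc t (fromℕ m))) (partialProduct-fromℕ (suc m) t)

  -- Along the path the recurrence always holds; the wrap from the last index to zero is the only
  -- place that needs the total product to be +.
  phase-next : product t ≡ Sign.+ → ∀ i → phase (next i) ≡ t i Sign.* phase i
  phase-next t≡+ i with view i
  ... | ‵fromℕ     = ≡.trans (≡.cong phase (next-fromℕ m)) (≡.sym (≡.trans phase-fromℕ t≡+))
  ... | ‵inject₁ j = ≡.trans (≡.cong phase (next-inject₁ j)) (phase-suc j)

module _ {m} (t : Fin (suc m) → Sign) {h : Vector ℝ (suc m)}
         (h-next : ∀ i → h (next i) ≈ signToℝ (t i) * h i) where

  signed-step : ∀ s i {y} → h i ≈ signToℝ s * y → h (next i) ≈ signToℝ (t i Sign.* s) * y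
  signed-step s i {y} hi≈sy = trans (h-next i) (trans (*-congˡ hi≈sy)
    (trans (sym (*-assoc (signToℝ (t i)) (signToℝ s) y)) (*-congʳ (sym (signToℝ-* (t i) s)))))

  determined-by-zero : ∀ i → h i ≈ signToℝ (phase t i) * h zero
  determined-by-zero = <-weakInduction (λ i → h i ≈ signToℝ (phase t i) * h zero)
    (sym (*-identityˡ (h zero))) step
    where
    step : ∀ i → h (inject₁ i) ≈ signToℝ (phase t (inject₁ i)) * h zero →
           h (suc i) ≈ signToℝ (phase t (suc i)) * h zero
    step i ih = ≡.subst₂ (λ j s → h j ≈ signToℝ s * h zero)
      (next-inject₁ i) (≡.sym (phase-suc t i)) (signed-step (phase t (inject₁ i)) (inject₁ i) ih)

  -- Following the recurrence to the last index and then through the wrap collects every factor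
  -- exactly once.
  monodromy : h zero ≈ signToℝ (product t) * h zero
  monodromy = ≡.subst₂ (λ j s → h j ≈ signToℝ s * h zero) (next-fromℕ m) (phase-fromℕ t)
    (signed-step (phase t (fromℕ m)) (fromℕ m) (determined-by-zero (fromℕ m)))

-- Induction in steps of two, which change neither the parity nor the sign.
product-parity : ∀ n → (2 ∣ n × product {n} (λ _ → Sign.-) ≡ Sign.+) ⊎
                       (¬ 2 ∣ n × product {n} (λ _ → Sign.-) ≡ Sign.-)
product-parity zero          = inj₁ (2 ℕ.∣0 , ≡.refl)
product-parity (suc zero)    = inj₂ ((λ 2∣1 → contradiction (ℕ.∣⇒≤ 2∣1) λ { (s≤s ()) }) , ≡.refl)
product-parity (suc (suc n)) with product-parity n
... | inj₁ (2∣n , eq) = inj₁ (ℕ.∣m∣n⇒∣m+n ℕ.∣-refl 2∣n , ≡.cong (Sign.opposite ∘ Sign.opposite) eq)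
... | inj₂ (2∤n , eq) = inj₂
  ((λ 2∣2+n → 2∤n (ℕ.∣m+n∣m⇒∣n 2∣2+n ℕ.∣-refl)) , ≡.cong (Sign.opposite ∘ Sign.opposite) eq)

-- Linear algebra

open import Algebra.Properties.Semiring.Sum semiring
open import Relation.Binary.Reasoning.Setoid setoid

sum-≈0 : ∀ {n} {f : Vector ℝ n} → (∀ i → f i ≈ 0ℝ) → sum f ≈ 0ℝ
sum-≈0 {n} f≈0 = trans (sum-cong-≋ f≈0) (sum-replicate-zero n)

sum-linear : ∀ {n} a b (f g : Vector ℝ n) →
             sum (λ i → a * f i + b * g i) ≈ a * sum f + b * sum g
sum-linear a b f g = trans (∑-distrib-+ (λ i → a * f i) (λ i → b * g i))
  (sym (+-cong (*-distribˡ-sum a f) (*-distribˡ-sum b g)))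

-- Inner products

dot : ∀ {n} → Vector ℝ n → Vector ℝ n → ℝ
dot f g = sum λ i → f i * g i

dot-cong : ∀ {n} {f f′ g g′ : Vector ℝ n} → (∀ i → f i ≈ f′ i) → (∀ i → g i ≈ g′ i) →
           dot f g ≈ dot f′ g′
dot-cong f≈f′ g≈g′ = sum-cong-≋ λ i → *-cong (f≈f′ i) (g≈g′ i)

dot-comm : ∀ {n} (f g : Vector ℝ n) → dot f g ≈ dot g f
dot-comm f g = sum-cong-≋ λ i → *-comm (f i) (g i)

dot-linearˡ : ∀ {n} a b (f g h : Vector ℝ n) →
              dot (λ i → a * f i + b * g i) h ≈ a * dot f h + b * dot g h
dot-linearˡ a b f g h = trans
  (sum-cong-≋ λ i → solve 5 (λ a b f g h → (a :* f :+ b :* g) :* h := a :* (f :* h) :+ b :* (g :* h))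
                      refl a b (f i) (g i) (h i))
  (sum-linear a b (λ i → f i * h i) (λ i → g i * h i))

dot-linearʳ : ∀ {n} a b (f g h : Vector ℝ n) →
              dot h (λ i → a * f i + b * g i) ≈ a * dot h f + b * dot h g
dot-linearʳ a b f g h = trans (dot-comm h _)
  (trans (dot-linearˡ a b f g h) (+-cong (*-congˡ (dot-comm f h)) (*-congˡ (dot-comm g h))))

dot-lincombˡ : ∀ {m k} (c : Fin k → ℝ) (v : Fin k → Vector ℝ m) g →
               dot (lincomb c v) g ≈ sum λ k → c k * dot (v k) g
dot-lincombˡ c v g = begin
  dot (lincomb c v) g
    ≈⟨ sum-cong-≋ (λ i → *-distribʳ-sum (g i) (λ k → c k * v k i)) ⟩
  (sum λ i → sum λ k → c k * v k i * g i)           ≈⟨ ∑-comm (λ i k → c k * v k i * g i) ⟩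
  (sum λ k → sum λ i → c k * v k i * g i)           ≈⟨ sum-cong-≋ (λ k → sum-cong-≋ λ i →
    solve 3 (λ x y z → x :* y :* z := x :* (y :* z)) refl (c k) (v k i) (g i)) ⟩
  (sum λ k → sum λ i → c k * (v k i * g i))
    ≈⟨ sum-cong-≋ (λ k → *-distribˡ-sum (c k) (λ i → v k i * g i)) ⟨
  (sum λ k → c k * dot (v k) g)                     ∎

dot-lincomb≈0 : ∀ {m k} {c : Fin k → ℝ} {v : Fin k → Vector ℝ m} {w g} →
                (∀ i → w i ≈ lincomb c v i) → (∀ k → dot (v k) g ≈ 0ℝ) → dot w g ≈ 0ℝ
dot-lincomb≈0 {c = c} {v} {w} {g} w≈ v⊥g = begin
  dot w g                          ≈⟨ dot-cong w≈ (λ _ → refl) ⟩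
  dot (lincomb c v) g              ≈⟨ dot-lincombˡ c v g ⟩
  (sum λ k → c k * dot (v k) g)    ≈⟨ sum-≈0 (λ k → trans (*-congˡ (v⊥g k)) (zeroʳ (c k))) ⟩
  0ℝ                               ∎

sum-nonNegative : ∀ {n} {f : Vector ℝ n} →
                  (∀ i → TermwiseNonNegative (f i)) → TermwiseNonNegative (sum f)
sum-nonNegative {zero}  0≤f n = ℚ.≤-refl
sum-nonNegative {suc n} {f} 0≤f = nonNegative-+ {f zero} {sum (f ∘ suc)} (0≤f zero)
  (sum-nonNegative {f = f ∘ suc} (0≤f ∘ suc))

-- Squares have termwise nonnegative representatives, so a vanishing sum of them squeezes each
-- summand to 0.
dot-self-definite : ∀ {n} (f : Vector ℝ n) → dot f f ≈ 0ℝ → ∀ i → f i ≈ 0ℝ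
dot-self-definite {suc n} f f·f≈0 = λ where
    zero    → x²≈0⇒x≈0 (x+y≈0⇒x≈0 head≥0 tail≥0 f·f≈0)
    (suc i) → dot-self-definite (f ∘ suc)
                (x+y≈0⇒x≈0 tail≥0 head≥0
                  (trans (+-comm (dot (f ∘ suc) (f ∘ suc)) (f zero * f zero)) f·f≈0)) i
  where
  head≥0 = square-nonNegative (f zero)
  tail≥0 : TermwiseNonNegative (dot (f ∘ suc) (f ∘ suc))
  tail≥0 = sum-nonNegative {f = λ i → f (suc i) * f (suc i)} λ i → square-nonNegative (f (suc i))

-- Linear combinations and dependence

lincomb-removeAt : ∀ {m k} (c : Vector ℝ (suc k)) j (v : Fin (suc k) → Vector ℝ m) i →
                   lincomb c v i ≈ c j * v j i + lincomb (removeAt c j) (removeAt v j) i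
lincomb-removeAt c j v i = sum-remove {i = j} λ k → c k * v k i

lincomb-insertAt : ∀ {m k} (c : Vector ℝ k) j a (v : Fin (suc k) → Vector ℝ m) i →
                   lincomb (insertAt c j a) v i ≈ a * v j i + lincomb c (removeAt v j) i
lincomb-insertAt c j a v i = trans (lincomb-removeAt (insertAt c j a) j v i)
  (+-cong (*-congʳ (reflexive (insertAt-lookup c j a)))
          (sum-cong-≋ λ k → *-congʳ (reflexive (insertAt-punchIn c j a k))))

-- A negative statement: no particular nonzero coordinate is exhibited. This suffices for drawing
-- stable conclusions.
NonZeroVector : ∀ {n} → Vector ℝ n → Set
NonZeroVector c = ¬ (∀ k → c k ≈ 0ℝ)

scale≈0⇒≈0 : ∀ {n} {f : Vector ℝ n} {a} → NonZeroVector f → (∀ i → a * f i ≈ 0ℝ) → a ≈ 0ℝ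
scale≈0⇒≈0 f≉0 af≈0 = ≈0-stable λ a≉0 → f≉0 λ i → *-cancelˡ-≉0 a≉0 (af≈0 i)

-- Elimination needs a nonzero pivot, and finding one is not constructive.  It
-- is cross-multiplied so that the pivot need not be inverted.
dependent : ∀ {m} (v : Fin (suc m) → Vector ℝ m) →
            ¬ ¬ ∃ λ c → NonZeroVector c × ∀ i → lincomb c v i ≈ 0ℝ
dependent {zero}  v ¬dep = ¬dep ((λ _ → 1ℝ) , (λ 1≈0 → 1≉0 (1≈0 zero)) , λ ())
dependent {suc m} v ¬dep = ¬¬-excluded-middle λ where
    (no  ¬pivot)      → withoutPivot λ j → ≈0-stable λ ≉0 → ¬pivot (j , ≉0)
    (yes (j , pivot)) → withPivot j pivot
  where
  withoutPivot : ¬ (∀ j → v j zero ≈ 0ℝ)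
  -- The first coordinates impose no condition, so vector `zero` gets coefficient 0 and the others,
  -- truncated to m coordinates, are still one too many.
  withoutPivot row≈0 = dependent (λ k i → v (suc k) (suc i)) λ (c , c≉0 , dep) →
    ¬dep (insertAt c zero 0ℝ , (λ ≈0 → c≉0 (≈0 ∘ suc)) , λ where
      zero    → sum-≈0 λ k → trans (*-congˡ (row≈0 k)) (zeroʳ (insertAt c zero 0ℝ k))
      (suc i) → trans (+-cong (zeroˡ (v zero (suc i))) (dep i)) (+-identityˡ 0ℝ))

  withPivot : ∀ j → ¬ ¬ v j zero ≈ 0ℝ
  withPivot j p≉0 = dependent v′ λ (c , c≉0 , dep) →
    -- The coefficient at j is chosen so that the whole combination equals ∑ c k (p u k - (u k zero)
    -- v j), whose first coordinate cancels identically.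
    ¬dep ( insertAt (λ k → p * c k) j (- sum λ k → c k * u k zero)
         , (λ ≈0 → c≉0 λ k → *-cancelˡ-≉0 p≉0
             (trans (reflexive (≡.sym (insertAt-punchIn (λ k → p * c k) j _ k))) (≈0 (punchIn j k))))
         , λ where
             zero    → trans (eliminate c zero) (sum-≈0 λ k →
               solve 3 (λ c u p → c :* (p :* u :- u :* p) := con 0ℚ) refl (c k) (u k zero) p)
             (suc i) → trans (eliminate c (suc i)) (dep i) )
    where
    p = v j zero
    u : Fin (suc m) → Vector ℝ (suc m)
    u = removeAt v j
    reduced : Fin (suc m) → Vector ℝ (suc m)
    reduced k i = p * u k i + - (u k zero * v j i)
    v′ : Fin (suc m) → Vector ℝ m
    v′ k i = reduced k (suc i)
    eliminate : ∀ c i → lincomb (insertAt (λ k → p * c k) j (- sum λ k → c k * u k zero)) v i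
                        ≈ lincomb c reduced i
    eliminate c i = begin
      lincomb (insertAt (λ k → p * c k) j (- q)) v i
        ≈⟨ lincomb-insertAt (λ k → p * c k) j (- q) v i ⟩
      - q * y + (sum λ k → p * c k * u k i)            ≈⟨ +-congˡ (sum-cong-≋ λ k →
        solve 3 (λ x y z → x :* y :* z := x :* (y :* z)) refl p (c k) (u k i)) ⟩
      - q * y + (sum λ k → p * (c k * u k i))          ≈⟨ +-cong
        (solve 2 (λ q y → (:- q) :* y := (:- y) :* q) refl q y)
        (sym (*-distribˡ-sum p (λ k → c k * u k i))) ⟩
      - y * q + p * (sum λ k → c k * u k i)
        ≈⟨ sum-linear (- y) p (λ k → c k * u k zero) (λ k → c k * u k i) ⟨
      (sum λ k → - y * (c k * u k zero) + p * (c k * u k i))  ≈⟨ sum-cong-≋ (λ k →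
        solve 5 (λ y c z p w → (:- y) :* (c :* z) :+ p :* (c :* w) := c :* (p :* w :- z :* y)) refl
          y (c k) (u k zero) p (u k i)) ⟩
      lincomb c reduced i                              ∎
      where
      q = sum λ k → c k * u k zero
      y = v j i

-- The m + 2 vectors f, g, u in dimension m + 1 are dependent. In such a relation, h = a f + b g
-- lies in the span of u and is orthogonal to u, so h is orthogonal to itself and vanishes.
-- Independence of u then kills the remaining coefficients, so a and b cannot both be zero.
dependent-orthogonal :
  ∀ {m} (u : Fin m → Vector ℝ (suc m)) → LinearlyIndependent u → (f g : Vector ℝ (suc m)) →
  (∀ k → dot (u k) f ≈ 0ℝ) → (∀ k → dot (u k) g ≈ 0ℝ) →
  ¬ ¬ ∃₂ λ a b → ¬ (a ≈ 0ℝ × b ≈ 0ℝ) × ∀ i → a * f i + b * g i ≈ 0ℝ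
dependent-orthogonal {m} u indep f g u⊥f u⊥g ¬goal = dependent (f ∷ g ∷ u) λ (c , c≉0 , dep) →
  let a = c zero
      b = c (suc zero)
      c′ : Fin m → ℝ
      c′ = λ k → c (suc (suc k))
      h : Vector ℝ (suc m)
      h = λ i → a * f i + b * g i
      u⊥h : ∀ k → dot (u k) h ≈ 0ℝ
      u⊥h = λ k → trans (dot-linearʳ a b f g (u k)) (trans
        (+-cong (trans (*-congˡ (u⊥f k)) (zeroʳ a)) (trans (*-congˡ (u⊥g k)) (zeroʳ b)))
        (+-identityˡ 0ℝ))
      h≈-lincomb : ∀ i → h i ≈ lincomb (λ k → - c′ k) u i
      h≈-lincomb = λ i → trans (x+y+z≈0⇒x+y≈-1*z (dep i)) (trans
        (*-distribˡ-sum (- 1ℝ) (λ k → c′ k * u k i))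
        (sum-cong-≋ λ k → solve 2 (λ c u → (:- con 1ℚ) :* (c :* u) := (:- c) :* u) refl (c′ k) (u k i)))
      h≈0 : ∀ i → h i ≈ 0ℝ
      h≈0 = dot-self-definite h (dot-lincomb≈0 {g = h} h≈-lincomb u⊥h)
      c′≈0 : ∀ k → c′ k ≈ 0ℝ
      c′≈0 = indep c′ λ i → trans (x+y+z≈0⇒z≈-[x+y] (dep i)) (trans (-‿cong (h≈0 i)) -0≈0)
  in ¬goal (a , b , (λ (a≈0 , b≈0) → c≉0 λ where
       zero          → a≈0
       (suc zero)    → b≈0
       (suc (suc k)) → c′≈0 k) , h≈0)
  where
  -0≈0 : - 0ℝ ≈ 0ℝ
  -0≈0 = solve 0 (:- con 0ℚ := con 0ℚ) refl
  x+y+z≈0⇒x+y≈-1*z : ∀ {x y z} → x + (y + z) ≈ 0ℝ → x + y ≈ - 1ℝ * z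
  x+y+z≈0⇒x+y≈-1*z {x} {y} {z} eq = x-y≈0⇒x≈y (trans
    (solve 3 (λ x y z → (x :+ y) :- ((:- con 1ℚ) :* z) := x :+ (y :+ z)) refl x y z) eq)
  x+y+z≈0⇒z≈-[x+y] : ∀ {x y z} → x + (y + z) ≈ 0ℝ → z ≈ - (x + y)
  x+y+z≈0⇒z≈-[x+y] {x} {y} {z} eq = x-y≈0⇒x≈y (trans
    (solve 3 (λ x y z → z :- (:- (x :+ y)) := x :+ (y :+ z)) refl x y z) eq)

sum-single : ∀ {n} (f : Vector ℝ n) j → (∀ k → k ≢ j → f k ≈ 0ℝ) → sum f ≈ f j
sum-single {suc n} f j f≈0 = trans (sum-remove {i = j} f) (trans
  (+-congˡ (sum-≈0 λ k → f≈0 (punchIn j k) (Fin.punchInᵢ≢i j k))) (+-identityʳ (f j)))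

-- Signed shifts

module SignedShift {n} (ν : Permutation′ n) (s : Fin n → Sign) where

  T T⁻¹ : Vector ℝ n → Vector ℝ n
  T   h v = signToℝ (s v) * h (ν ⟨$⟩ʳ v)
  T⁻¹ h v = signToℝ (s (ν ⟨$⟩ˡ v)) * h (ν ⟨$⟩ˡ v)

  -- The matrix of `T`; its transpose is the matrix of `T⁻¹`.
  entry : Matrix n n
  entry v w = if does (ν ⟨$⟩ʳ v Fin.≟ w) then signToℝ (s v) else 0ℝ

  entry-≡ : ∀ {v w} → ν ⟨$⟩ʳ v ≡ w → entry v w ≈ signToℝ (s v)
  entry-≡ {v} {w} νv≡w with ν ⟨$⟩ʳ v Fin.≟ w
  ... | yes _    = refl
  ... | no νv≢w  = contradiction νv≡w νv≢w

  entry-≢ : ∀ {v w} → ν ⟨$⟩ʳ v ≢ w → entry v w ≈ 0ℝ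
  entry-≢ {v} {w} νv≢w with ν ⟨$⟩ʳ v Fin.≟ w
  ... | yes νv≡w = contradiction νv≡w νv≢w
  ... | no _     = refl

  sum-entryʳ : ∀ h v → (sum λ w → h w * entry v w) ≈ T h v
  sum-entryʳ h v = trans
    (sum-single _ (ν ⟨$⟩ʳ v) λ w w≢νv → trans (*-congˡ (entry-≢ (w≢νv ∘ ≡.sym))) (zeroʳ (h w)))
    (trans (*-congˡ (entry-≡ ≡.refl)) (*-comm _ _))

  sum-entryˡ : ∀ h w → (sum λ v → h v * entry v w) ≈ T⁻¹ h w
  sum-entryˡ h w = trans
    (sum-single _ (ν ⟨$⟩ˡ w) λ v v≢ν⁻w → trans
      (*-congˡ (entry-≢ λ νv≡w → v≢ν⁻w (≡.trans (≡.sym (inverseˡ ν)) (≡.cong (ν ⟨$⟩ˡ_) νv≡w))))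
      (zeroʳ (h v)))
    (trans (*-congˡ (entry-≡ (inverseʳ ν))) (*-comm _ _))

  T⁻¹-cong : ∀ {f g} → (∀ v → f v ≈ g v) → ∀ v → T⁻¹ f v ≈ T⁻¹ g v
  T⁻¹-cong f≈g v = *-congˡ (f≈g (ν ⟨$⟩ˡ v))

  signs-cancel : ∀ t y → signToℝ t * (signToℝ t * y) ≈ y
  signs-cancel t y = trans (sym (*-assoc _ _ _)) (trans (*-congʳ (signToℝ-square t)) (*-identityˡ y))

  T-T⁻¹ : ∀ h v → T (T⁻¹ h) v ≈ h v
  T-T⁻¹ h v rewrite inverseˡ ν {v} = signs-cancel (s v) (h v)

  T⁻¹-T : ∀ h v → T⁻¹ (T h) v ≈ h v
  T⁻¹-T h v rewrite inverseʳ ν {v} = signs-cancel (s (ν ⟨$⟩ˡ v)) (h v)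

  -- Reindexing the sum along ν⁻¹ moves the shift to the other factor; the sign may stand on either
  -- side.
  T-adjoint : ∀ f g → dot (T f) g ≈ dot f (T⁻¹ g)
  T-adjoint f g = trans (∑-permute (λ v → T f v * g v) (flip ν)) (sum-cong-≋ step)
    where
    step : ∀ v → T f (ν ⟨$⟩ˡ v) * g (ν ⟨$⟩ˡ v) ≈ f v * T⁻¹ g v
    step v rewrite inverseʳ ν {v} =
      solve 3 (λ s f g → s :* f :* g := f :* (s :* g)) refl (signToℝ (s (ν ⟨$⟩ˡ v))) (f v) (g (ν ⟨$⟩ˡ v))

  T-isometric : ∀ f → dot (T f) (T f) ≈ dot f f
  T-isometric f = trans (T-adjoint f (T f)) (dot-cong (λ _ → refl) (T⁻¹-T f))

  -- The eigenvector equation of T + T⁻¹, with the zero vector allowed.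
  Eigen : ℝ → Vector ℝ n → Set
  Eigen x h = ∀ v → x * h v ≈ T h v + T⁻¹ h v

  -- `T` commutes with T + T⁻¹: apply `T` to the equation for h.
  T-preserves-Eigen : ∀ {x h} → Eigen x h → Eigen x (T h)
  T-preserves-Eigen {x} {h} eigen v = begin
    x * (signToℝ (s v) * h w)
      ≈⟨ solve 3 (λ x s h → x :* (s :* h) := s :* (x :* h)) refl x (signToℝ (s v)) (h w) ⟩
    signToℝ (s v) * (x * h w)                    ≈⟨ *-congˡ (eigen w) ⟩
    signToℝ (s v) * (T h w + T⁻¹ h w)
      ≈⟨ solve 3 (λ s a b → s :* (a :+ b) := s :* a :+ s :* b) refl (signToℝ (s v)) (T h w) (T⁻¹ h w) ⟩
    T (T h) v + T (T⁻¹ h) v                      ≈⟨ +-congˡ (trans (T-T⁻¹ h v) (sym (T⁻¹-T h v))) ⟩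
    T (T h) v + T⁻¹ (T h) v                      ∎
    where w = ν ⟨$⟩ʳ v

  module _ (c : Sign) where
    private γ = signToℝ c

    T⁻¹-eigen : ∀ {h} → (∀ v → T h v ≈ γ * h v) → ∀ v → T⁻¹ h v ≈ γ * h v
    T⁻¹-eigen {h} Th≈γh v = begin
      T⁻¹ h v                          ≈⟨ signs-cancel c (T⁻¹ h v) ⟨
      γ * (γ * T⁻¹ h v)
        ≈⟨ *-congˡ (solve 3 (λ c s h → c :* (s :* h) := s :* (c :* h)) refl
                      γ (signToℝ (s (ν ⟨$⟩ˡ v))) (h (ν ⟨$⟩ˡ v))) ⟩
      γ * T⁻¹ (λ w → γ * h w) v        ≈⟨ *-congˡ (T⁻¹-cong Th≈γh v) ⟨
      γ * T⁻¹ (T h) v                  ≈⟨ *-congˡ (T⁻¹-T h v) ⟩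
      γ * h v                          ∎

    T-eigen⇒Eigen : ∀ {h} → (∀ v → T h v ≈ γ * h v) → Eigen (γ * 2ℝ) h
    T-eigen⇒Eigen {h} Th≈γh v = trans
      (solve 2 (λ c h → c :* (con 1ℚ :+ con 1ℚ) :* h := c :* h :+ c :* h) refl γ (h v))
      (sym (+-cong (Th≈γh v) (T⁻¹-eigen Th≈γh v)))

    eigenvalue : ∀ {x h} → NonZeroVector h → (∀ v → T h v ≈ γ * h v) → Eigen x h → x ≈ γ * 2ℝ
    eigenvalue {x} {h} h≉0 Th≈γh eigen = x-y≈0⇒x≈y (scale≈0⇒≈0 h≉0 λ v → trans
      (solve 3 (λ x y h → (x :- y) :* h := x :* h :- y :* h) refl x (γ * 2ℝ) (h v))
      (x≈y⇒x-y≈0 (trans (eigen v) (sym (T-eigen⇒Eigen Th≈γh v)))))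

    -- T is orthogonal, so ‖Th − γh‖² = 2⟨h,h⟩ − 2γ⟨h,Th⟩ = γ⟨h,(2γ − T − T⁻¹)h⟩.
    Eigen⇒T-eigen : ∀ {h} → Eigen (γ * 2ℝ) h → ∀ v → T h v ≈ γ * h v
    Eigen⇒T-eigen {h} eigen v = x-y≈0⇒x≈y (trans
      (solve 3 (λ t c h → t :- c :* h := con 1ℚ :* t :+ (:- c) :* h) refl (T h v) γ (h v))
      (dot-self-definite u u·u≈0 v))
      where
      u : Vector ℝ n
      u v = 1ℝ * T h v + - γ * h v
      H S : ℝ
      H = dot h h
      S = dot (T h) h
      γ*2*H≈S+S : γ * 2ℝ * H ≈ S + S
      γ*2*H≈S+S = begin
        γ * 2ℝ * H
          ≈⟨ solve 2 (λ y H → y :* H := y :* H :+ con 0ℚ :* H) refl (γ * 2ℝ) H ⟩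
        γ * 2ℝ * H + 0ℝ * H                          ≈⟨ dot-linearˡ (γ * 2ℝ) 0ℝ h h h ⟨
        dot (λ v → γ * 2ℝ * h v + 0ℝ * h v) h        ≈⟨ dot-cong (λ v → trans
          (solve 2 (λ y h → y :* h :+ con 0ℚ :* h := y :* h) refl (γ * 2ℝ) (h v))
          (trans (eigen v) (solve 2 (λ a b → a :+ b := con 1ℚ :* a :+ con 1ℚ :* b)
                              refl (T h v) (T⁻¹ h v)))) (λ _ → refl) ⟩
        dot (λ v → 1ℝ * T h v + 1ℝ * T⁻¹ h v) h      ≈⟨ dot-linearˡ 1ℝ 1ℝ (T h) (T⁻¹ h) h ⟩
        1ℝ * S + 1ℝ * dot (T⁻¹ h) h
          ≈⟨ +-cong (*-identityˡ S) (trans (*-identityˡ _)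
          (trans (dot-comm (T⁻¹ h) h) (sym (T-adjoint h h)))) ⟩
        S + S                                        ∎
      u·u≈0 : dot u u ≈ 0ℝ
      u·u≈0 = begin
        dot u u                                              ≈⟨ dot-linearˡ 1ℝ (- γ) (T h) h u ⟩
        1ℝ * dot (T h) u + - γ * dot h u
          ≈⟨ +-cong (*-congˡ (dot-linearʳ 1ℝ (- γ) (T h) h (T h)))
                                                                       (*-congˡ (dot-linearʳ 1ℝ (- γ) (T h) h h)) ⟩
        1ℝ * (1ℝ * dot (T h) (T h) + - γ * S) + - γ * (1ℝ * dot h (T h) + - γ * H)
          ≈⟨ +-cong (*-congˡ (+-congʳ (*-congˡ (T-isometric h)))) (*-congˡ (+-congʳ (*-congˡ (dot-comm h (T h))))) ⟩
        1ℝ * (1ℝ * H + - γ * S) + - γ * (1ℝ * S + - γ * H)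
          ≈⟨ solve 3 (λ H c S → con 1ℚ :* (con 1ℚ :* H :+ (:- c) :* S) :+ (:- c) :* (con 1ℚ :* S :+ (:- c) :* H)
                                := H :+ c :* c :* H :- c :* (S :+ S)) refl H γ S ⟩
        H + γ * γ * H + - (γ * (S + S))
          ≈⟨ +-congˡ (-‿cong (*-congˡ γ*2*H≈S+S)) ⟨
        H + γ * γ * H + - (γ * (γ * 2ℝ * H))
          ≈⟨ solve 2 (λ H c → H :+ c :* c :* H :- c :* (c :* (con 1ℚ :+ con 1ℚ) :* H) := H :- c :* c :* H) refl H γ ⟩
        H + - (γ * γ * H)
          ≈⟨ x≈y⇒x-y≈0 (trans (sym (*-identityˡ H)) (*-congʳ (sym (signToℝ-square c)))) ⟩
        0ℝ                                                   ∎

  -- Taking norms in b T f = - a f gives b² H = a² H for H = ⟨f, f⟩, because `T` is isometric. As H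
  -- is nonzero, (b - a)(b + a) = 0, and each factor yields one of the two signs.
  dependent⇒T-eigen : ∀ {f a b} → NonZeroVector f → ¬ (a ≈ 0ℝ × b ≈ 0ℝ) →
                      (∀ v → a * f v + b * T f v ≈ 0ℝ) →
                      ¬ ¬ ∃ λ c → ∀ v → T f v ≈ signToℝ c * f v
  dependent⇒T-eigen {f} {a} {b} f≉0 ab≉0 dep ¬goal = ¬¬-excluded-middle {A = b + - a ≈ 0ℝ} λ where
      (yes b≈a) → ¬goal (conclude Sign.- (begin
        a + - 1ℝ * b  ≈⟨ solve 2 (λ a b → a :+ (:- con 1ℚ) :* b := :- (b :- a)) refl a b ⟩
        - (b + - a)   ≈⟨ -‿cong b≈a ⟩
        - 0ℝ          ≈⟨ solve 0 (:- con 0ℚ := con 0ℚ) refl ⟩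
        0ℝ            ∎))
      (no b≉a)  → ¬goal (conclude Sign.+ (trans (+-congˡ (*-identityˡ b)) (trans (+-comm a b)
        (*-cancelˡ-≉0 b≉a factored))))
    where
    H = dot f f
    squares : b * (b * H) ≈ a * (a * H)
    squares = begin
      b * (b * H)                                    ≈⟨ *-congˡ (*-congˡ (T-isometric f)) ⟨
      b * (b * dot (T f) (T f))                      ≈⟨ scale b (T f) ⟨
      dot (λ v → b * T f v) (λ v → b * T f v)        ≈⟨ dot-cong bTf≈-af bTf≈-af ⟩
      dot (λ v → - a * f v) (λ v → - a * f v)        ≈⟨ scale (- a) f ⟩
      - a * (- a * H)
        ≈⟨ solve 2 (λ a H → (:- a) :* ((:- a) :* H) := a :* (a :* H)) refl a H ⟩
      a * (a * H)                                    ∎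
      where
      bTf≈-af : ∀ v → b * T f v ≈ - a * f v
      bTf≈-af v = x-y≈0⇒x≈y (trans
        (solve 4 (λ a b f t → b :* t :- (:- a) :* f := a :* f :+ b :* t) refl a b (f v) (T f v)) (dep v))
      scale : ∀ y (g : Vector ℝ n) → dot (λ v → y * g v) (λ v → y * g v) ≈ y * (y * dot g g)
      scale y g = begin
        dot (λ v → y * g v) (λ v → y * g v)
          ≈⟨ sum-cong-≋ (λ v → solve 2 (λ y g → (y :* g) :* (y :* g) := (y :* y) :* (g :* g)) refl y (g v)) ⟩
        (sum λ v → y * y * (g v * g v))          ≈⟨ *-distribˡ-sum (y * y) (λ v → g v * g v) ⟨
        y * y * dot g g                          ≈⟨ *-assoc y y (dot g g) ⟩
        y * (y * dot g g)                        ∎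
    factored : (b + - a) * (b + a) ≈ 0ℝ
    factored = *-cancelˡ-≉0 {H} (λ H≈0 → f≉0 (dot-self-definite f H≈0)) (trans
      (solve 3 (λ H a b → H :* ((b :- a) :* (b :+ a)) := b :* (b :* H) :- a :* (a :* H)) refl H a b)
      (x≈y⇒x-y≈0 squares))
    conclude : ∀ c → a + signToℝ c * b ≈ 0ℝ → ∃ λ c → ∀ v → T f v ≈ signToℝ c * f v
    conclude c a+cb≈0 = c , λ v → x-y≈0⇒x≈y (*-cancelˡ-≉0 b≉0 (begin
      b * (T f v + - (γ * f v))                       ≈⟨ solve 5 (λ b t c f a → b :* (t :- c :* f)
        := (a :* f :+ b :* t) :- (a :+ c :* b) :* f) refl b (T f v) γ (f v) a ⟩
      (a * f v + b * T f v) + - ((a + γ * b) * f v)   ≈⟨ +-cong (dep v) (-‿cong (*-congʳ a+cb≈0)) ⟩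
      0ℝ + - (0ℝ * f v)
        ≈⟨ solve 1 (λ f → con 0ℚ :- con 0ℚ :* f := con 0ℚ) refl (f v) ⟩
      0ℝ                                              ∎))
      where
      γ = signToℝ c
      b≉0 : ¬ b ≈ 0ℝ
      -- Since a = - γ b, a vanishing b would make both coefficients vanish.
      b≉0 b≈0 = ab≉0 (trans (solve 3 (λ a c b → a := (a :+ c :* b) :- c :* b) refl a γ b)
        (trans (+-cong a+cb≈0 (-‿cong (*-congˡ b≈0))) (solve 1 (λ c → con 0ℚ :- c :* con 0ℚ := con 0ℚ) refl γ))
        , b≈0)

-- Spectrum of a signed cycle

identityMatrix-≡ : ∀ {n} (i : Fin n) → identityMatrix n i i ≈ 1ℝ
identityMatrix-≡ i with i Fin.≟ i
... | yes _  = refl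
... | no i≢i = contradiction ≡.refl i≢i

identityMatrix-≢ : ∀ {n} {i j : Fin n} → i ≢ j → identityMatrix n i j ≈ 0ℝ
identityMatrix-≢ {i = i} {j} i≢j with i Fin.≟ j
... | yes i≡j = contradiction i≡j i≢j
... | no _    = refl

identityMatrix-sym : ∀ {n} (i j : Fin n) → identityMatrix n i j ≈ identityMatrix n j i
identityMatrix-sym i j with i Fin.≟ j
... | yes ≡.refl = sym (identityMatrix-≡ i)
... | no i≢j     = sym (identityMatrix-≢ (i≢j ∘ ≡.sym))

sum-identityMatrix : ∀ {n} (h : Vector ℝ n) i → (sum λ j → identityMatrix n i j * h j) ≈ h i
sum-identityMatrix h i = trans
  (sum-single _ i λ j j≢i → trans (*-congʳ (identityMatrix-≢ (j≢i ∘ ≡.sym))) (zeroˡ (h j)))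
  (trans (*-congʳ (identityMatrix-≡ i)) (*-identityˡ (h i)))

inSpan-self : ∀ {m k} (v : Fin k → Vector ℝ m) j → InSpan v (v j)
inSpan-self {k = k} v j = identityMatrix k j , λ i → sym (sum-identityMatrix (λ j → v j i) j)

module SignedCycleSpectrum {m} (3≤n : 3 ≤ suc m) (G : SignedCycle (suc m)) where
  open SignedCycle G

  n : ℕ
  n = suc m

  -- `∘ₚ` composes left to right: vertex to index, rotate, index back to vertex.
  ν : Permutation′ n
  ν = flip labelling ∘ₚ rotation ∘ₚ labelling

  s : Fin n → Sign
  s v = σ v (ν ⟨$⟩ʳ v)

  t : Fin n → Sign
  t i = s (labelling ⟨$⟩ʳ i)

  open SignedShift ν s

  adj⇒ : ∀ {v w} → Adj v w → ν ⟨$⟩ʳ v ≡ w ⊎ ν ⟨$⟩ʳ w ≡ v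
  adj⇒ {v} {w} vw with Equivalence.to (adjacency (labelling ⟨$⟩ˡ v) (labelling ⟨$⟩ˡ w))
    (≡.subst₂ Adj (≡.sym (inverseʳ labelling)) (≡.sym (inverseʳ labelling)) vw)
  ... | inj₁ w≡next = inj₁ (≡.trans (≡.cong (labelling ⟨$⟩ʳ_) (≡.sym w≡next)) (inverseʳ labelling))
  ... | inj₂ v≡next = inj₂ (≡.trans (≡.cong (labelling ⟨$⟩ʳ_) (≡.sym v≡next)) (inverseʳ labelling))

  adj-labelling-next : ∀ i → Adj (labelling ⟨$⟩ʳ i) (labelling ⟨$⟩ʳ next i)
  adj-labelling-next i = Equivalence.from (adjacency i (next i)) (inj₁ ≡.refl)

  adj-ν : ∀ v → Adj v (ν ⟨$⟩ʳ v)
  adj-ν v = ≡.subst (λ w → Adj w (ν ⟨$⟩ʳ v)) (inverseʳ labelling) (adj-labelling-next (labelling ⟨$⟩ˡ v))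

  ν-labelling : ∀ i → ν ⟨$⟩ʳ (labelling ⟨$⟩ʳ i) ≡ labelling ⟨$⟩ʳ next i
  ν-labelling i = ≡.cong (λ j → labelling ⟨$⟩ʳ next j) (inverseˡ labelling)

  ν≢ν⁻¹ : ∀ v → ν ⟨$⟩ʳ v ≢ ν ⟨$⟩ˡ v
  ν≢ν⁻¹ v eq = next≢prev 3≤n (labelling ⟨$⟩ˡ v)
    (≡.trans (≡.sym (inverseˡ labelling)) (≡.trans (≡.cong (labelling ⟨$⟩ˡ_) eq) (inverseˡ labelling)))

  -- Ensures that an edge contributes to a matrix position through only one of its two orientations.
  ν-asym : ∀ {v w} → ν ⟨$⟩ʳ v ≡ w → ν ⟨$⟩ʳ w ≢ v
  ν-asym {v} {w} νv≡w νw≡v = ν≢ν⁻¹ v (≡.trans νv≡w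
    (≡.trans (≡.sym (inverseˡ ν)) (≡.cong (ν ⟨$⟩ˡ_) νw≡v)))

  ν-orbit : ∀ {p} (P : Pred (Fin n) p) → (∀ v → P v → P (ν ⟨$⟩ʳ v)) → ∀ {v} → P v → ∀ w → P w
  ν-orbit P closed Pv w = ≡.subst P (inverseʳ labelling) (next-closed (P ∘ (labelling ⟨$⟩ʳ_))
    (λ i Pi → ≡.subst P (ν-labelling i) (closed (labelling ⟨$⟩ʳ i) Pi))
    (≡.subst P (≡.sym (inverseʳ labelling)) Pv) (labelling ⟨$⟩ˡ w))

  -- This is A = T + T⁻¹ entry by entry. Each edge is traversed by ν in exactly one direction; in
  -- the reverse direction symmetry of σ supplies the sign.
  adjacencyMatrix-entry : ∀ v w → adjacencyMatrix signedGraph v w ≈ entry v w + entry w v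
  adjacencyMatrix-entry v w with adj? v w
  ... | no ¬vw = sym (trans
    (+-cong (entry-≢ λ νv≡w → ¬vw (≡.subst (Adj v) νv≡w (adj-ν v)))
            (entry-≢ λ νw≡v → ¬vw (symmetric (≡.subst (Adj w) νw≡v (adj-ν w)))))
    (+-identityˡ 0ℝ))
  ... | yes vw with adj⇒ vw
  ...   | inj₁ νv≡w = sym (trans (+-cong (entry-≡ νv≡w) (entry-≢ (ν-asym νv≡w)))
    (trans (+-identityʳ (signToℝ (s v))) (reflexive (≡.cong (signToℝ ∘ σ v) νv≡w))))
  ...   | inj₂ νw≡v = sym (trans (+-cong (entry-≢ (ν-asym νw≡v)) (entry-≡ νw≡v))
    (trans (+-identityˡ (signToℝ (s w)))
           (reflexive (≡.cong signToℝ (≡.trans (≡.cong (σ w) νw≡v) (σ-sym (symmetric vw)))))))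

  module _ (x : ℝ) where
    M : Matrix n n
    M = characteristicMatrix signedGraph x

    M-sym : ∀ v w → M v w ≈ M w v
    M-sym v w = +-cong (*-congˡ (identityMatrix-sym v w)) (-‿cong (begin
      adjacencyMatrix signedGraph v w   ≈⟨ adjacencyMatrix-entry v w ⟩
      entry v w + entry w v             ≈⟨ +-comm (entry v w) (entry w v) ⟩
      entry w v + entry v w             ≈⟨ adjacencyMatrix-entry w v ⟨
      adjacencyMatrix signedGraph w v   ∎))

    lincomb-columns : ∀ h v → lincomb h (column M) v ≈ x * h v + - (T h v + T⁻¹ h v)
    lincomb-columns h v = begin
      (sum λ w → h w * M v w)                                       ≈⟨ sum-cong-≋ (λ w → trans
        (*-congˡ (+-congˡ (-‿cong (adjacencyMatrix-entry v w))))
        (solve 5 (λ h x i a b → h :* (x :* i :- (a :+ b)) := x :* (i :* h) :+ (:- con 1ℚ) :* (h :* a :+ h :* b)) refl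
          (h w) x (identityMatrix n v w) (entry v w) (entry w v))) ⟩
      (sum λ w → x * I w + - 1ℝ * (A w + B w))
        ≈⟨ sum-linear x (- 1ℝ) I (λ w → A w + B w) ⟩
      x * sum I + - 1ℝ * sum (λ w → A w + B w)
        ≈⟨ +-cong (*-congˡ (sum-identityMatrix h v))
        (trans (solve 1 (λ y → (:- con 1ℚ) :* y := :- y) refl (sum λ w → A w + B w))
               (-‿cong (trans (∑-distrib-+ A B) (+-cong (sum-entryʳ h v) (sum-entryˡ h v))))) ⟩
      x * h v + - (T h v + T⁻¹ h v)                                 ∎
      where
      I A B : Vector ℝ n
      I w = identityMatrix n v w * h w
      A w = h w * entry v w
      B w = h w * entry w v

    lincomb≈0⇒Eigen : ∀ {h} → (∀ v → lincomb h (column M) v ≈ 0ℝ) → Eigen x h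
    lincomb≈0⇒Eigen {h} h-kernel v = x-y≈0⇒x≈y (trans (sym (lincomb-columns h v)) (h-kernel v))

    Eigen⇒lincomb≈0 : ∀ {h} → Eigen x h → ∀ v → lincomb h (column M) v ≈ 0ℝ
    Eigen⇒lincomb≈0 {h} eigen v = trans (lincomb-columns h v) (x≈y⇒x-y≈0 (eigen v))

    -- By symmetry of `M` the kernel is the orthogonal complement of the column space.
    lincomb≈dot-column : ∀ h w → lincomb h (column M) w ≈ dot (column M w) h
    lincomb≈dot-column h w = sum-cong-≋ λ v → trans (*-comm (h v) (M w v)) (*-congʳ (M-sym w v))

  Eigen-cong : ∀ {x y h} → x ≈ y → Eigen x h → Eigen y h
  Eigen-cong {h = h} x≈y eigen v = trans (*-congʳ (sym x≈y)) (eigen v)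

  v₀ : Fin n
  v₀ = labelling ⟨$⟩ʳ zero

  module _ (c : Sign) where
    γ : ℝ
    γ = signToℝ c

    -- The factor from one vertex to the next in a solution of T h = γ h; it is c t(i) because a
    -- sign is its own inverse.
    ratio : Fin n → Sign
    ratio i = c Sign.* t i

    module _ {h : Vector ℝ n} (Th≈γh : ∀ v → T h v ≈ γ * h v) where

      h-ν : ∀ v → h (ν ⟨$⟩ʳ v) ≈ signToℝ (c Sign.* s v) * h v
      h-ν v = begin
        h (ν ⟨$⟩ʳ v)                                        ≈⟨ signs-cancel (s v) (h (ν ⟨$⟩ʳ v)) ⟨
        signToℝ (s v) * T h v                               ≈⟨ *-congˡ (Th≈γh v) ⟩
        signToℝ (s v) * (γ * h v)
          ≈⟨ solve 3 (λ s c h → s :* (c :* h) := (c :* s) :* h) refl (signToℝ (s v)) γ (h v) ⟩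
        γ * signToℝ (s v) * h v                             ≈⟨ *-congʳ (signToℝ-* c (s v)) ⟨
        signToℝ (c Sign.* s v) * h v                        ∎

      h-next : ∀ i → h (labelling ⟨$⟩ʳ next i) ≈ signToℝ (ratio i) * h (labelling ⟨$⟩ʳ i)
      h-next i = ≡.subst (λ w → h w ≈ signToℝ (ratio i) * h (labelling ⟨$⟩ʳ i)) (ν-labelling i)
        (h-ν (labelling ⟨$⟩ʳ i))

      vanishing : h v₀ ≈ 0ℝ → ∀ v → h v ≈ 0ℝ
      vanishing h₀≈0 v = ≡.subst (λ w → h w ≈ 0ℝ) (inverseʳ labelling) (trans
        (determined-by-zero ratio {h ∘ (labelling ⟨$⟩ʳ_)} h-next (labelling ⟨$⟩ˡ v))
        (trans (*-congˡ h₀≈0) (zeroʳ _)))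

      -- A full turn with total sign - would force h v₀ = - h v₀ = 0, and then h vanishes
      -- everywhere.
      closing-up : NonZeroVector h → product ratio ≡ Sign.+
      closing-up h≉0 = sign≡+ (product ratio) (monodromy ratio {h ∘ (labelling ⟨$⟩ʳ_)} h-next)
        where
        sign≡+ : ∀ p → h v₀ ≈ signToℝ p * h v₀ → p ≡ Sign.+
        sign≡+ Sign.+ _       = ≡.refl
        sign≡+ Sign.- h₀≈-h₀ = contradiction (vanishing (x+x≈0⇒x≈0 (trans
          (solve 1 (λ y → y :+ y := y :- (:- con 1ℚ) :* y) refl (h v₀)) (x≈y⇒x-y≈0 h₀≈-h₀)))) h≉0

    rank : ∀ {x} → product ratio ≡ Sign.+ → x ≈ γ * 2ℝ → HasRank (characteristicMatrix signedGraph x) m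
    rank {x} closes x≈2γ = record
      { basis         = basis
      ; inColumnSpace = λ k → inSpan-self (column (M x)) (punchIn v₀ k)
      ; independent   = independent
      ; spanning      = spanning
      }
      where
      f : Vector ℝ n
      -- The product of ratios being +, the phase closes up around the cycle and gives an
      -- eigenvector of `T`, normalised to 1 at `v₀`.
      f v = signToℝ (phase ratio (labelling ⟨$⟩ˡ v))

      f₀≈1 : f v₀ ≈ 1ℝ
      f₀≈1 = reflexive (≡.cong (λ i → signToℝ (phase ratio i)) (inverseˡ labelling))

      f-ν : ∀ v → f (ν ⟨$⟩ʳ v) ≈ signToℝ (c Sign.* s v) * f v
      f-ν v = trans
        (reflexive (≡.cong signToℝ (≡.trans (≡.cong (phase ratio) (inverseˡ labelling))
          (≡.trans (phase-next ratio closes (labelling ⟨$⟩ˡ v))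
                   (≡.cong (λ w → c Sign.* s w Sign.* phase ratio (labelling ⟨$⟩ˡ v)) (inverseʳ labelling))))))
        (signToℝ-* (c Sign.* s v) (phase ratio (labelling ⟨$⟩ˡ v)))

      Tf≈γf : ∀ v → T f v ≈ γ * f v
      Tf≈γf v = begin
        signToℝ (s v) * f (ν ⟨$⟩ʳ v)
          ≈⟨ *-congˡ (trans (f-ν v) (*-congʳ (signToℝ-* c (s v)))) ⟩
        signToℝ (s v) * (γ * signToℝ (s v) * f v)
          ≈⟨ solve 3 (λ s c f → s :* (c :* s :* f) := s :* (s :* (c :* f))) refl (signToℝ (s v)) γ (f v) ⟩
        signToℝ (s v) * (signToℝ (s v) * (γ * f v))         ≈⟨ signs-cancel (s v) (γ * f v) ⟩
        γ * f v                                             ∎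

      f-kernel : ∀ v → lincomb f (column (M x)) v ≈ 0ℝ
      f-kernel = Eigen⇒lincomb≈0 x (Eigen-cong (sym x≈2γ) (T-eigen⇒Eigen c Tf≈γf))

      basis : Fin m → Vector ℝ n
      basis = removeAt (column (M x)) v₀

      independent : LinearlyIndependent basis
      independent d d-kernel k = trans (sym (reflexive (insertAt-punchIn d v₀ 0ℝ k))) (h≈0 (punchIn v₀ k))
        where
        h : Vector ℝ n
        -- A relation among the other columns, extended by 0 at `v₀`, is a kernel vector that
        -- vanishes at `v₀`, hence everywhere.
        h = insertAt d v₀ 0ℝ
        h-kernel : ∀ v → lincomb h (column (M x)) v ≈ 0ℝ
        h-kernel v = trans (lincomb-insertAt d v₀ 0ℝ (column (M x)) v)
          (trans (+-cong (zeroˡ (M x v v₀)) (d-kernel v)) (+-identityˡ 0ℝ))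
        h≈0 : ∀ v → h v ≈ 0ℝ
        h≈0 = vanishing (Eigen⇒T-eigen c (Eigen-cong x≈2γ (lincomb≈0⇒Eigen x h-kernel)))
          (reflexive (insertAt-lookup d v₀ 0ℝ))

      -- Subtracting d v₀ · f from the coefficients d removes the column at v₀.
      spanning : ∀ w → InSpan (column (M x)) w → InSpan basis w
      spanning w (d , w≈) = removeAt e v₀ , λ v → begin
        w v                                                              ≈⟨ w≈ v ⟩
        lincomb d (column (M x)) v
          ≈⟨ solve 2 (λ y d → y := con 1ℚ :* y :+ (:- d) :* con 0ℚ) refl (lincomb d (column (M x)) v) (d v₀) ⟩
        1ℝ * lincomb d (column (M x)) v + - d v₀ * 0ℝ
          ≈⟨ +-congˡ (*-congˡ (f-kernel v)) ⟨
        1ℝ * lincomb d (column (M x)) v + - d v₀ * lincomb f (column (M x)) v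
          ≈⟨ dot-linearˡ 1ℝ (- d v₀) d f (M x v) ⟨
        lincomb e (column (M x)) v
          ≈⟨ lincomb-removeAt e v₀ (column (M x)) v ⟩
        e v₀ * M x v v₀ + lincomb (removeAt e v₀) basis v
          ≈⟨ +-congʳ (trans (*-congʳ e₀≈0) (zeroˡ (M x v v₀))) ⟩
        0ℝ + lincomb (removeAt e v₀) basis v                             ≈⟨ +-identityˡ _ ⟩
        lincomb (removeAt e v₀) basis v                                  ∎
        where
        e : Vector ℝ n
        e v = 1ℝ * d v + - d v₀ * f v
        e₀≈0 : e v₀ ≈ 0ℝ
        e₀≈0 = trans (+-congˡ (*-congˡ f₀≈1)) (solve 1 (λ d → con 1ℚ :* d :+ (:- d) :* con 1ℚ := con 0ℚ) refl (d v₀))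

  rank⇒¬¬eigenvalue : ∀ {x} → HasRank (characteristicMatrix signedGraph x) m →
                      ¬ ¬ ∃ λ c → product (ratio c) ≡ Sign.+ × x ≈ signToℝ c * 2ℝ
  rank⇒¬¬eigenvalue {x} hasRank ¬goal =
    -- Transposing the basis gives m + 1 vectors with m coordinates; a dependency among them is a
    -- nonzero f orthogonal to every basis vector.
    dependent (λ v k → basis k v) λ (f , f≉0 , f⊥) →
    let f-eigen : Eigen x f
        f-eigen = lincomb≈0⇒Eigen x λ v → trans (lincomb≈dot-column x f v)
          (dot-lincomb≈0 {g = f} (proj₂ (spanning (column (M x) v) (inSpan-self (column (M x)) v)))
            λ k → trans (dot-comm (basis k) f) (f⊥ k))
        -- T f is again in the kernel, hence orthogonal to all columns and so to the basis, whose
        -- members are combinations of columns.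
        Tf⊥ : ∀ k → dot (basis k) (T f) ≈ 0ℝ
        Tf⊥ = λ k → dot-lincomb≈0 {c = proj₁ (inColumnSpace k)} {column (M x)} {g = T f}
          (proj₂ (inColumnSpace k)) λ v →
          trans (sym (lincomb≈dot-column x (T f) v)) (Eigen⇒lincomb≈0 x (T-preserves-Eigen f-eigen) v)
    in dependent-orthogonal basis independent f (T f) (λ k → trans (dot-comm (basis k) f) (f⊥ k)) Tf⊥
         λ (a , b , ab≉0 , dep) → dependent⇒T-eigen f≉0 ab≉0 dep
         λ (c , Tf≈γf) → ¬goal (c , closing-up c Tf≈γf f≉0 , eigenvalue c f≉0 Tf≈γf f-eigen)
    where open HasRank hasRank

  hasRank⇔eigenvalue : ∀ {x} → HasRank (characteristicMatrix signedGraph x) m ⇔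
                       ∃ λ c → product (ratio c) ≡ Sign.+ × x ≈ signToℝ c * 2ℝ
  hasRank⇔eigenvalue {x} = mk⇔ to λ (c , closes , x≈2γ) → rank c closes x≈2γ
    where
    Eigenvalue : Sign → Set
    Eigenvalue c = product (ratio c) ≡ Sign.+ × x ≈ signToℝ c * 2ℝ
    stable : ∀ c → ¬ ¬ Eigenvalue c → Eigenvalue c
    stable c ¬¬e = decidable-stable (product (ratio c) Sign.≟ Sign.+) (λ ¬p → ¬¬e (¬p ∘ proj₁))
                   , ≈-stable (λ ¬p → ¬¬e (¬p ∘ proj₂))
    -- x cannot be both 2 and −2, so one of the two signs is excluded outright.
    to : HasRank (characteristicMatrix signedGraph x) m → ∃ Eigenvalue
    to hasRank with ≉2⊎≉-2 x
    ... | inj₁ x≉2  = Sign.- , stable Sign.- λ ¬e → rank⇒¬¬eigenvalue hasRank λ where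
      (Sign.+ , _ , x≈2) → x≉2 (trans x≈2 (*-identityˡ 2ℝ))
      (Sign.- , e)       → ¬e e
    ... | inj₂ x≉-2 = Sign.+ , stable Sign.+ λ ¬e → rank⇒¬¬eigenvalue hasRank λ where
      (Sign.+ , e)        → ¬e e
      (Sign.- , _ , x≈-2) → x≉-2 (trans x≈-2 (solve 1 (λ y → (:- con 1ℚ) :* y := :- y) refl 2ℝ))

-- Girth and multiplicity

module _ {m} (3≤n : 3 ≤ suc m) (G : SignedCycle (suc m)) where
  open SignedCycle G
  open SignedCycleSpectrum 3≤n G

  labelling-injective : ∀ {i j} → labelling ⟨$⟩ʳ i ≡ labelling ⟨$⟩ʳ j → i ≡ j
  labelling-injective eq =
    ≡.trans (≡.sym (inverseˡ labelling)) (≡.trans (≡.cong (labelling ⟨$⟩ˡ_) eq) (inverseˡ labelling))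

  fullCycle : Cycle graph n
  fullCycle = record
    { 3≤length  = 3≤n
    ; vertex    = labelling ⟨$⟩ʳ_
    ; injective = labelling-injective
    ; adjacent  = adj-labelling-next
    }

  -- A vertex of a cycle has two distinct neighbours on it, while it has only
  -- two neighbours in Cₙ: the vertices of a cycle are closed under ν.
  module _ {l} (C : Cycle graph l) where
    open Cycle C

    OnCycle : Fin n → Set
    OnCycle v = ∃ λ i → vertex i ≡ v

    ν-onCycle : ∀ v → OnCycle v → OnCycle (ν ⟨$⟩ʳ v)
    ν-onCycle v (i , ≡.refl) with adj⇒ (adjacent i)
    ... | inj₁ ν≡next = next i , ≡.sym ν≡next
    ... | inj₂ ν-next≡ with adj⇒ (symmetric
      (≡.subst (λ j → Adj (vertex (prev i)) (vertex j)) (next-prev i) (adjacent (prev i))))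
    ...   | inj₁ ν≡prev  = prev i , ≡.sym ν≡prev
    -- Otherwise ν sends both cycle neighbours of the vertex to it, so they coincide.
    ...   | inj₂ ν-prev≡ = contradiction (injective (ν-injective (≡.trans ν-next≡ (≡.sym ν-prev≡))))
                             (next≢prev 3≤length i)
      where
      ν-injective : ∀ {v w} → ν ⟨$⟩ʳ v ≡ ν ⟨$⟩ʳ w → v ≡ w
      ν-injective eq = ≡.trans (≡.sym (inverseˡ ν)) (≡.trans (≡.cong (ν ⟨$⟩ˡ_) eq) (inverseˡ ν))

    onCycle : ∀ v → OnCycle v
    onCycle = ν-orbit OnCycle ν-onCycle (fromℕ< (ℕ.≤-trans (s≤s z≤n) 3≤length) , ≡.refl)

    -- Choosing a position on the cycle for each vertex is injective, because the position
    -- determines the vertex.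
    n≤length : n ≤ l
    n≤length = Fin.injective⇒≤ {f = λ v → proj₁ (onCycle v)} λ {v} {w} eq →
      ≡.trans (≡.sym (proj₂ (onCycle v))) (≡.trans (≡.cong vertex eq) (proj₂ (onCycle w)))

  isGirth : IsGirth graph n
  isGirth = fullCycle , n≤length

  -- The right-hand side is cⁿ ε, so a product of ratios equal to + is the closing condition cⁿ ε =
  -- 1.
  product-ratio : ∀ c → product (ratio c) ≡ product {n} (λ _ → c) Sign.* signProduct
  product-ratio c = ≡.trans (product-* {n} (λ _ → c) t) (≡.cong (product {n} (λ _ → c) Sign.*_)
    (product-cong λ i → ≡.cong (σ (labelling ⟨$⟩ʳ i)) (ν-labelling i)))

  product-ratio-+ : product (ratio Sign.+) ≡ signProduct
  product-ratio-+ = ≡.trans (product-ratio Sign.+) (≡.cong (Sign._* signProduct) (product-+ n))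

  SpecialCases : ℝ → Set
  SpecialCases x = (Balanced G × x ≈ 2ℝ) ⊎
                   (Balanced G × 2 ∣ n × x ≈ - 2ℝ) ⊎
                   (Unbalanced G × ¬ (2 ∣ n) × x ≈ - 2ℝ)

  -1*2≈-2 : - 1ℝ * 2ℝ ≈ - 2ℝ
  -1*2≈-2 = solve 1 (λ y → (:- con 1ℚ) :* y := :- y) refl 2ℝ

  eigenvalue⇔special : ∀ {x} → (∃ λ c → product (ratio c) ≡ Sign.+ × x ≈ signToℝ c * 2ℝ) ⇔ SpecialCases x
  eigenvalue⇔special {x} = mk⇔ to from
    where
    to : (∃ λ c → product (ratio c) ≡ Sign.+ × x ≈ signToℝ c * 2ℝ) → SpecialCases x
    to (Sign.+ , closes , x≈) = inj₁ (≡.trans (≡.sym product-ratio-+) closes , trans x≈ (*-identityˡ 2ℝ))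
    to (Sign.- , closes , x≈) with product-parity n | ≡.trans (≡.sym (product-ratio Sign.-)) closes
    ... | inj₁ (even , eq) | p rewrite eq = inj₂ (inj₁ (p , even , trans x≈ -1*2≈-2))
    ... | inj₂ (odd , eq)  | p rewrite eq = inj₂ (inj₂ (unbalanced signProduct p , odd , trans x≈ -1*2≈-2))
      where
      unbalanced : ∀ s → Sign.- Sign.* s ≡ Sign.+ → s ≢ Sign.+
      unbalanced Sign.- _ ()
    negative : ∀ {p} → product {n} (λ _ → Sign.-) ≡ p → p Sign.* signProduct ≡ Sign.+ → x ≈ - 2ℝ →
               ∃ λ c → product (ratio c) ≡ Sign.+ × x ≈ signToℝ c * 2ℝ
    negative ≡.refl closes x≈-2 = Sign.- , ≡.trans (product-ratio Sign.-) closes , trans x≈-2 (sym -1*2≈-2)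
    from : SpecialCases x → ∃ λ c → product (ratio c) ≡ Sign.+ × x ≈ signToℝ c * 2ℝ
    from (inj₁ (bal , x≈2)) = Sign.+ , ≡.trans product-ratio-+ bal , trans x≈2 (sym (*-identityˡ 2ℝ))
    from (inj₂ (inj₁ (bal , even , x≈-2))) with product-parity n
    ... | inj₁ (_ , eq)  = negative eq bal x≈-2
    ... | inj₂ (odd , _) = contradiction even odd
    from (inj₂ (inj₂ (unbal , odd , x≈-2))) with product-parity n
    ... | inj₁ (even , _) = contradiction even odd
    ... | inj₂ (_ , eq)   = negative eq (-*s≡+ signProduct unbal) x≈-2
      where
      -*s≡+ : ∀ s → s ≢ Sign.+ → Sign.- Sign.* s ≡ Sign.+
      -*s≡+ Sign.+ s≢+ = contradiction ≡.refl s≢+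
      -*s≡+ Sign.- _   = ≡.refl

  multiplicity⇔special : ∀ {x} → HasMultiplicity signedGraph x 1 ⇔ SpecialCases x
  multiplicity⇔special {x} = eigenvalue⇔special ⇔-∘ (hasRank⇔eigenvalue ⇔-∘ mk⇔
    (λ (r , hasRank , 1+r≡n) →
      ≡.subst (HasRank (characteristicMatrix signedGraph x)) (ℕ.suc-injective 1+r≡n) hasRank)
    (λ hasRank → m , hasRank , ≡.refl))

isGirth-unique : ∀ {n} {G : Graph n} {g h} → IsGirth G g → IsGirth G h → g ≡ h
isGirth-unique (C , shortest) (C′ , shortest′) = ℕ.≤-antisym (shortest C′) (shortest′ C)

theorem4 : ∀ (n : ℕ) → 3 ≤ n → (G : SignedCycle n) →
    IsGirth (SignedCycle.graph G) n ×
    (∀ (g : ℕ) → IsGirth (SignedCycle.graph G) g → (x : ℝ) →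
    HasMultiplicity (SignedCycle.signedGraph G) x (n ∸ g ℕ.+ 1) ⇔
    ((Balanced G × x ≈ 2ℝ) ⊎
    (Balanced G × 2 ∣ n × x ≈ - 2ℝ) ⊎
    (Unbalanced G × ¬ (2 ∣ n) × x ≈ - 2ℝ)))
theorem4 (suc m) 3≤n G = isGirth 3≤n G , λ g g-girth x →
  -- Any girth `g` equals the order, so the multiplicity in question is 1.
  ≡.subst (λ k → HasMultiplicity (SignedCycle.signedGraph G) x k ⇔ SpecialCases 3≤n G x)
    (≡.sym (≡.trans (≡.cong (λ g → suc m ∸ g ℕ.+ 1) (isGirth-unique g-girth (isGirth 3≤n G)))
                    (≡.cong (ℕ._+ 1) (ℕ.n∸n≡0 (suc m)))))
    (multiplicity⇔special 3≤n G)
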